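{- Let $G=(V,E)$ be a connected graph, $G'=(V,E')$ a graph with $E\subseteq E'$, and $e\in E'$. In case $e\in E$, the inequality $0\le x_e$ defines a facet of $\Xi_{GG'}$ if and only if there is no triangle in $G'$ containing $e$. In case $uv=e\in F_{GG'}$, the inequality $0\le x_e$ defines a facet of $\Xi_{GG'}$ only if the following necessary conditions hold: (a) There is no triangle in $G'$ containing $e$. (b) The distance in $G'$ of any pair of (distinct) $u$-$v$-cut-vertices, except the pair $\{u,v\}$, is at least $3$. (c) There is no triangle of nodes $s,s',t$ in $G'$ such that $\{s,s'\}$ is a $u$-$v$-separating node set and $t$ is a $u$-$v$-cut-vertex.
   Context: All graphs are finite, simple and undirected; an edge $\{v,w\}$ is also written $vw$. Paths and cycles have no repeated nodes and are identified with their edge sets; a triangle is a cycle of length $3$. For distinct $v,w\in V$, $vw\text{ -paths}(G)$ is the set of all paths in $G$ from $v$ to $w$; a $vw$-cut of $G$ is an inclusion-minimal set $C\subseteq E$ such that $v$ and $w$ are not connected in $(V,E\setminus C)$, and $vw\text{ -cuts}(G)$ is the set of all of these. For a connected graph $G=(V,E)$ and a graph $G'=(V,E')$ with $E\subseteq E'$, let $F_{GG'}:=E'\setminus E$ and let $X_{GG'}$ be the set of all $x\in\{0,1\}^{E'}$ such that (i) $x_e\le\sum_{e'\in C\setminus\{e\}}x_{e'}$ for every cycle $C$ of $G$ and every $e\in C$; (ii) $x_{vw}\le\sum_{e\in P}x_e$ for every $vw\in F_{GG'}$ and every $P\in vw\text{ -paths}(G)$; (iii) $1-x_{vw}\le\sum_{e\in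 C}(1-x_e)$ for every $vw\in F_{GG'}$ and every $C\in vw\text{ -cuts}(G)$. The lifted multicut polytope is $\Xi_{GG'}:=\operatorname{conv}X_{GG'}\subset\mathbb{R}^{E'}$. A $u$-$v$-cut-vertex is a node of $V$ that lies on every $uv$-path of $G$ (in particular $u$ and $v$ are). A node set is $u$-$v$-separating if every $uv$-path of $G$ contains at least one of its nodes. -}

module Defs where

open import Level using (Level; _⊔_; 0ℓ) renaming (suc to lsuc)
open import Algebra.Apartness using (HeytingField; HeytingCommutativeRing)
open import Algebra.Bundles using (CommutativeRing)
open import Data.Empty using (⊥-elim)
open import Data.Fin using (Fin; _<_)
open import Data.Fin.Properties using (<-cmp)
open import Data.Integer as ℤ using (ℤ; +_; 1ℤ)
open import Data.List using (List; []; _∷_; foldr; length; map)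
open import Data.List.Membership.Propositional using (_∈_; _∉_)
open import Data.List.Relation.Binary.Permutation.Propositional using (_↭_)
open import Data.List.Relation.Binary.Subset.Propositional using (_⊆_)
open import Data.List.Relation.Unary.Any using (Any; _─_)
open import Data.List.Relation.Unary.Unique.Propositional using (Unique)
open import Data.Nat as ℕ using (ℕ)
open import Data.Product using (Σ-syntax; _×_; _,_; proj₁)
open import Data.Sum using (_⊎_)
open import Function using (_∘_; const)
open import Relation.Binary.Construct.Closure.ReflexiveTransitive using (Star; ε; _◅_)
open import Relation.Binary
  using (Rel; Decidable; Symmetric; IsStrictPartialOrder; tri<; tri≈; tri>)
open import Relation.Binary.PropositionalEquality using (_≡_; refl)
open import Relation.Nullary using (¬_)
open import Relation.Unary using (Pred)

private
  variable
    n : ℕ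

------------------------------------------------------------------------
-- Graphs

record Graph (n : ℕ) : Set₁ where
  field
    Adj        : Rel (Fin n) 0ℓ
    adj?       : Decidable Adj
    adj-sym    : Symmetric Adj
    adj-irrefl : ∀ {v} → ¬ Adj v v

open Graph public using (Adj)

-- An edge {v,w} is represented by its increasing pair of end nodes.  The
-- proofs are irrelevant, so edges are equal as soon as their ends are.
record Edge (G : Graph n) : Set where
  constructor mkEdge
  field
    lo hi  : Fin n
    .lo<hi : lo < hi
    .adj   : Adj G lo hi

edge : (G : Graph n) {v w : Fin n} → Adj G v w → Edge G
edge G {v} {w} a with <-cmp v w
... | tri< v<w _ _  = mkEdge v w v<w a
... | tri≈ _ refl _ = ⊥-elim (Graph.adj-irrefl G a)
... | tri> _ _ w<v  = mkEdge w v w<v (Graph.adj-sym G a)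

infix 4 _⊆ᴳ_

_⊆ᴳ_ : Graph n → Graph n → Set
G ⊆ᴳ H = ∀ {v w} → Adj G v w → Adj H v w

inclᴱ : {G H : Graph n} → G ⊆ᴳ H → Edge G → Edge H
inclᴱ G⊆H (mkEdge v w v<w a) = mkEdge v w v<w (G⊆H a)

Connected : Graph n → Set
Connected G = ∀ v w → Star (Adj G) v w

module _ (G : Graph n) where

  Walk : Fin n → Fin n → Set
  Walk = Star (Adj G)

  walkNodes : ∀ {v w} → Walk v w → List (Fin n)
  walkNodes {v} ε       = v ∷ []
  walkNodes {v} (_ ◅ p) = v ∷ walkNodes p

  walkEdges : ∀ {v w} → Walk v w → List (Edge G)
  walkEdges ε       = []
  walkEdges (a ◅ p) = edge G a ∷ walkEdges p

  -- Edge sets (of paths, cycles and cuts) are duplicate-free lists of edges;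
  -- for paths and cycles this follows from the nodes being distinct.

  Path : Fin n → Fin n → Set
  Path v w = Σ[ p ∈ Walk v w ] Unique (walkNodes p)

  pathNodes : ∀ {v w} → Path v w → List (Fin n)
  pathNodes (p , _) = walkNodes p

  pathEdges : ∀ {v w} → Path v w → List (Edge G)
  pathEdges (p , _) = walkEdges p

  -- A path with at least two edges, closed up by an edge between its ends.
  record Cycle : Set where
    field
      {first last} : Fin n
      path         : Path first last
      closing      : Adj G last first
      long         : 2 ℕ.≤ length (pathEdges path)

    nodes : List (Fin n)
    nodes = pathNodes path

    edges : List (Edge G)
    edges = edge G closing ∷ pathEdges path

  Triangle : Set
  Triangle = Σ[ C ∈ Cycle ] length (Cycle.edges C) ≡ 3

  InTriangle : Edge G → Set
  InTriangle e = Σ[ T ∈ Triangle ] e ∈ Cycle.edges (proj₁ T)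

  TriangleOn : Fin n → Fin n → Fin n → Set
  TriangleOn a b c =
    Σ[ T ∈ Triangle ] Cycle.nodes (proj₁ T) ↭ (a ∷ b ∷ c ∷ [])

  -- The node pair is connected in (V , E ∖ C).
  ConnectedWithout : List (Edge G) → Fin n → Fin n → Set
  ConnectedWithout C =
    Star (λ v w → Σ[ a ∈ Adj G v w ] edge G a ∉ C)

  record IsCut (v w : Fin n) (C : List (Edge G)) : Set where
    field
      unique    : Unique C
      separates : ¬ ConnectedWithout C v w
      minimal   : ∀ {D} → D ⊆ C → ¬ ConnectedWithout D v w → C ⊆ D

  -- The distance, i.e. the least number of edges of a path, is at least k.
  DistanceAtLeast : ℕ → Fin n → Fin n → Set
  DistanceAtLeast k v w = (P : Path v w) → k ℕ.≤ length (pathEdges P)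

  IsCutVertex : Fin n → Fin n → Fin n → Set
  IsCutVertex u v t = (P : Path u v) → t ∈ pathNodes P

  IsSeparating : Fin n → Fin n → List (Fin n) → Set
  IsSeparating u v S = (P : Path u v) → Any (_∈ S) (pathNodes P)

------------------------------------------------------------------------
-- Ordered fields

-- The scalars of the polyhedral theory.  Under excluded middle these are
-- exactly the ordered fields (with _#_ the negation of _≈_).  Asking for
-- apartness instead of decidable equality keeps the real numbers an
-- instance constructively; ℚ is one as well.
record OrderedField (c ℓ₁ ℓ₂ ℓ₃ : Level) : Set (lsuc (c ⊔ ℓ₁ ⊔ ℓ₂ ⊔ ℓ₃)) where
  infix 4 _<ᴷ_ _≤ᴷ_
  field
    heytingField : HeytingField c ℓ₁ ℓ₂

  open HeytingField heytingField public

  commutativeRing : CommutativeRing c ℓ₁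
  commutativeRing =
    HeytingCommutativeRing.commutativeRing heytingCommutativeRing

  field
    _<ᴷ_                 : Rel Carrier ℓ₃
    isStrictPartialOrder : IsStrictPartialOrder _≈_ _<ᴷ_
    #⇒<⊎>                : ∀ {x y} → x # y → x <ᴷ y ⊎ y <ᴷ x
    <⇒#                  : ∀ {x y} → x <ᴷ y → x # y
    +-monoˡ-<            : ∀ {x y} z → x <ᴷ y → x + z <ᴷ y + z
    *-pos                : ∀ {x y} → 0# <ᴷ x → 0# <ᴷ y → 0# <ᴷ x * y

  _≤ᴷ_ : Rel Carrier ℓ₃
  x ≤ᴷ y = ¬ (y <ᴷ x)

------------------------------------------------------------------------
-- Polytopes in Kᴵ

module Polyhedra {c ℓ₁ ℓ₂ ℓ₃} (K : OrderedField c ℓ₁ ℓ₂ ℓ₃) (I : Set) where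

  open OrderedField K
  open CommutativeRing commutativeRing using (+-commutativeMonoid)
  open import Algebra.Properties.CommutativeMonoid.Sum +-commutativeMonoid
    using (sum)

  Point : Set c
  Point = I → Carrier

  record Conv {ℓ} (X : Pred Point ℓ) (p : Point)
              : Set (c ⊔ ℓ₁ ⊔ ℓ₃ ⊔ ℓ) where
    field
      size        : ℕ
      weight      : Fin size → Carrier
      point       : Fin size → Point
      point∈X     : ∀ j → X (point j)
      nonneg      : ∀ j → 0# ≤ᴷ weight j
      total       : sum weight ≈ 1#
      combination : ∀ i → p i ≈ sum (λ j → weight j * point j i)

  AffinelyIndependent : ∀ {k} → (Fin k → Point) → Set (c ⊔ ℓ₁)
  AffinelyIndependent {k} q =
    (α : Fin k → Carrier) →
    sum α ≈ 0# → (∀ i → sum (λ j → α j * q j i) ≈ 0#) →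
    ∀ j → α j ≈ 0#

  -- The maximal number of affinely independent points of S is d + 1; in
  -- particular the empty set has dimension -1.
  record HasDimension {ℓ} (S : Pred Point ℓ) (d : ℤ)
                      : Set (c ⊔ ℓ₁ ⊔ ℓ) where
    field
      size        : ℕ
      dimension   : d ≡ + size ℤ.- 1ℤ
      point       : Fin size → Point
      point∈S     : ∀ j → S (point j)
      independent : AffinelyIndependent point
      maximal     : ∀ {k} (q : Fin k → Point) → (∀ j → S (q j)) →
                    AffinelyIndependent q → k ℕ.≤ size

  -- The inequality f x ≤ g x defines a facet of P.
  record DefinesFacet {ℓ} (P : Pred Point ℓ) (f g : Point → Carrier)
                      : Set (c ⊔ ℓ₁ ⊔ ℓ₃ ⊔ ℓ) where
    field
      valid  : ∀ {x} → P x → f x ≤ᴷ g x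
      d      : ℤ
      dim    : HasDimension P d
      dimF   : HasDimension (λ x → P x × f x ≈ g x) (d ℤ.- 1ℤ)

------------------------------------------------------------------------
-- The lifted multicut polytope

module LiftedMulticut {c ℓ₁ ℓ₂ ℓ₃} (K : OrderedField c ℓ₁ ℓ₂ ℓ₃)
                      {n} (G G′ : Graph n) (G⊆G′ : G ⊆ᴳ G′) where

  open OrderedField K
  open Polyhedra K (Edge G′) public

  sumOver : List (Edge G) → (Edge G′ → Carrier) → Carrier
  sumOver C y = foldr _+_ 0# (map (y ∘ inclᴱ G⊆G′) C)

  record X (x : Point) : Set (c ⊔ ℓ₁ ⊔ ℓ₃) where
    field
      binary : ∀ e → x e ≈ 0# ⊎ x e ≈ 1#
      cycles : (C : Cycle G) {e : Edge G} (e∈C : e ∈ Cycle.edges C) →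
               x (inclᴱ G⊆G′ e) ≤ᴷ sumOver (Cycle.edges C ─ e∈C) x
      paths  : ∀ {v w} (vw : Adj G′ v w) → ¬ Adj G v w →
               (P : Path G v w) →
               x (edge G′ vw) ≤ᴷ sumOver (pathEdges G P) x
      cuts   : ∀ {v w} (vw : Adj G′ v w) → ¬ Adj G v w →
               ∀ {C} → IsCut G v w C →
               1# - x (edge G′ vw) ≤ᴷ sumOver C (λ e → 1# - x e)

  Ξ : Pred Point (c ⊔ ℓ₁ ⊔ ℓ₃)
  Ξ = Conv X

  LowerBoundDefinesFacet : Edge G′ → Set (c ⊔ ℓ₁ ⊔ ℓ₃)
  LowerBoundDefinesFacet e = DefinesFacet Ξ (const 0#) (λ x → x e)

{-# OPTIONS --safe #-}

-- Points of X correspond to decompositions of V into classes connected in G: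
-- x_vw = 0 if and only if v and w are joined in G by edges of value 0.
--
-- Necessity: each violated condition yields a linear equation ψ(x) = 0 valid
-- on the face x_e = 0, because in x one of the classes contains u and v and
-- hence all u-v-cut-vertices.  For s, t, r with edges sr and tr it is
-- x_tr = x_sr, for an edge st it is x_st = 0, and for a separating triangle
-- x_st + x_s't = x_ss'.  Merging a single path of G gives a point off the face
-- with another value of ψ than the all-ones point, so adding both points to
-- the face raises the dimension by two.
--
-- Sufficiency: merge uv and, for each edge f of G', the nodes of a shortest
-- walk of G/uv between the ends of f.  Any other edge of G' merged in this
-- way is closer in G/uv, as G'/uv has no parallel edges.  So the points are
-- unitriangular with respect to that distance, and together with the
-- all-ones point they are affinely independent.
module Submission where

open import Defs
open import Algebra.Bundles using (CommutativeRing)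
open import Data.Empty using (⊥; ⊥-elim; ⊥-elim-irr)
open import Data.Fin using (Fin; zero; suc; punchIn; _<?_)
open import Data.Fin.Induction using (spo-noetherian)
open import Data.Fin.Properties using (<-cmp; punchInᵢ≢i; _≟_; any?) renaming (<-asym to <ᶠ-asym)
open import Data.Integer as ℤ using (+_; 1ℤ)
import Data.Integer.Properties as ℤ
open import Data.List using (List; []; _∷_; length; allFin; concatMap; deduplicate; filter; foldr;
  lookup; map)
open import Data.List.Membership.Propositional using (_∈_; _∉_; lose)
open import Data.List.Membership.Propositional.Properties
  using (∈-allFin; ∈-concatMap⁺; ∈-deduplicate⁺; ∈-filter⁺; ∈-filter⁻; ∈-lookup)
open import Data.List.Properties using (filter-notAll)
open import Data.List.Relation.Binary.Permutation.Propositional using (↭-sym; ↭⇒↭ₛ)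
open import Data.List.Relation.Binary.Permutation.Propositional.Properties using (∈-resp-↭)
import Data.List.Relation.Binary.Permutation.Setoid.Properties as Permutation
open import Data.List.Relation.Binary.Subset.Propositional using (_⊆_)
open import Data.List.Relation.Unary.All as All using (All; []; _∷_)
open import Data.List.Relation.Unary.All.Properties using (¬Any⇒All¬; All¬⇒¬Any)
open import Data.List.Relation.Unary.AllPairs using ([]; _∷_)
open import Data.List.Relation.Unary.Any as Any using (Any; here; there; index; _─_)
open import Data.List.Relation.Unary.Any.Properties using (lookup-index)
open import Data.List.Relation.Unary.Unique.DecPropositional.Properties using (deduplicate-!)
open import Data.List.Relation.Unary.Unique.Propositional using (Unique)
open import Data.List.Relation.Unary.Unique.Propositional.Properties using (filter⁺)
open import Data.Nat as ℕ using (ℕ; zero; suc; z≤n; s≤s)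
open import Data.Nat.Induction using (<-wellFounded)
import Data.Nat.Properties as ℕ
open import Data.Product using (Σ-syntax; ∃-syntax; _×_; _,_; proj₁; proj₂)
open import Data.Sum as Sum using (_⊎_; inj₁; inj₂; swap; [_,_]′)
open import Data.Unit using (⊤; tt)
open import Data.Vec.Functional using (insertAt) renaming (_∷_ to _∷ᵛ_)
open import Data.Vec.Functional.Properties using (insertAt-lookup; insertAt-punchIn)
open import Function using (id; _∘_; const)
open import Function.Bundles using (_⇔_; mk⇔)
open import Induction.WellFounded using (Acc; acc)
open import Level using (Level; 0ℓ; Lift; lift)
open import Relation.Binary
  using (Rel; Decidable; DecidableEquality; IsEquivalence; IsStrictPartialOrder; tri<; tri≈; tri>)
open import Relation.Binary.Construct.Closure.ReflexiveTransitive as Star using (Star; ε; _◅_; _◅◅_)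
import Relation.Binary.Construct.On as On
open import Relation.Binary.PropositionalEquality as ≡
  using (_≡_; _≢_; refl; sym; trans; cong; subst)
open import Relation.Nullary using (¬_; Dec; yes; no; contradiction; recompute)
open import Relation.Nullary.Decidable using (map′; ¬?; _×-dec_; _⊎-dec_)
open import Relation.Unary using (Pred)

open Edge using (lo; hi)

private
  variable
    n : ℕ
    ℓ ℓ′ : Level
    u v w : Fin n

-- Edges

-- Forgets which end `edge` stores as `lo`, so that later proofs need not repeat the comparison of
-- the two nodes.
Ends : {G : Graph n} → Edge G → Rel (Fin n) 0ℓ
Ends e v w = (lo e ≡ v × hi e ≡ w) ⊎ (lo e ≡ w × hi e ≡ v)

ends-edge : (G : Graph n) (a : Adj G v w) → Ends (edge G a) v w
ends-edge {v = v} {w} G a with <-cmp v w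
... | tri< _ _ _    = inj₁ (refl , refl)
... | tri≈ _ refl _ = ⊥-elim (Graph.adj-irrefl G a)
... | tri> _ _ _    = inj₂ (refl , refl)

-- Ends are stored in increasing order, so the crossed cases contradict asymmetry; in the others the
-- irrelevant proofs leave nothing to compare.
ends-injective : {G : Graph n} {e f : Edge G} → Ends e v w → Ends f v w → e ≡ f
ends-injective {e = mkEdge _ _ _ _} {mkEdge _ _ _ _} (inj₁ (refl , refl)) (inj₁ (refl , refl)) = refl
ends-injective {e = mkEdge _ _ p _} {mkEdge _ _ q _} (inj₁ (refl , refl)) (inj₂ (refl , refl)) = ⊥-elim-irr (<ᶠ-asym p q)
ends-injective {e = mkEdge _ _ p _} {mkEdge _ _ q _} (inj₂ (refl , refl)) (inj₁ (refl , refl)) = ⊥-elim-irr (<ᶠ-asym p q)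
ends-injective {e = mkEdge _ _ _ _} {mkEdge _ _ _ _} (inj₂ (refl , refl)) (inj₂ (refl , refl)) = refl

edge-cong : (G : Graph n) (a b : Adj G v w) → edge G a ≡ edge G b
edge-cong G a b = ends-injective (ends-edge G a) (ends-edge G b)

edge-swap : (G : Graph n) (a : Adj G v w) (b : Adj G w v) → edge G a ≡ edge G b
edge-swap G a b = ends-injective (ends-edge G a) (swap (ends-edge G b))

ends-inclᴱ : (G H : Graph n) (G⊆H : G ⊆ᴳ H) {e : Edge G} →
             Ends e v w → Ends (inclᴱ {G = G} {H} G⊆H e) v w
ends-inclᴱ G H G⊆H {mkEdge _ _ _ _} p = p

inclᴱ-edge : (G H : Graph n) (G⊆H : G ⊆ᴳ H) (a : Adj G v w) →
             inclᴱ {G = G} {H} G⊆H (edge G a) ≡ edge H (G⊆H a)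
inclᴱ-edge G H G⊆H a =
  ends-injective (ends-inclᴱ G H G⊆H {edge G a} (ends-edge G a)) (ends-edge H (G⊆H a))

-- The stored adjacency proof is irrelevant and is recovered from decidability.
edge-adj : (G : Graph n) (e : Edge G) → Adj G (lo e) (hi e)
edge-adj G (mkEdge v w _ a) = recompute (Graph.adj? G v w) a

ends-unique : {G : Graph n} {e : Edge G} {a b : Fin n} →
              Ends e v w → Ends e a b → (v ≡ a × w ≡ b) ⊎ (v ≡ b × w ≡ a)
ends-unique (inj₁ (refl , refl)) (inj₁ (refl , refl)) = inj₁ (refl , refl)
ends-unique (inj₁ (refl , refl)) (inj₂ (refl , refl)) = inj₂ (refl , refl)
ends-unique (inj₂ (refl , refl)) (inj₁ (refl , refl)) = inj₂ (refl , refl)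
ends-unique (inj₂ (refl , refl)) (inj₂ (refl , refl)) = inj₁ (refl , refl)

module _ (G : Graph n) where

  infix 4 _≟ᴱ_

  _≟ᴱ_ : DecidableEquality (Edge G)
  e ≟ᴱ f = map′ (λ (p , q) → ends-injective (inj₁ (refl , refl)) (inj₁ (sym p , sym q)))
                (λ { refl → refl , refl })
                ((lo e ≟ lo f) ×-dec (hi e ≟ hi f))

  private
    edgesBetween : Fin n → Fin n → List (Edge G)
    edgesBetween v w with v <? w | Graph.adj? G v w
    ... | yes v<w | yes a = mkEdge v w v<w a ∷ []
    ... | _       | _     = []

    ∈-edgesBetween : (e : Edge G) → e ∈ edgesBetween (lo e) (hi e)
    ∈-edgesBetween e@(mkEdge v w v<w a) with v <? w | Graph.adj? G v w
    ... | yes _ | yes _ = here refl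
    ... | no ¬p | _     = ⊥-elim-irr (¬p v<w)
    ... | yes _ | no ¬a = ⊥-elim-irr (¬a a)

  allEdges : List (Edge G)
  allEdges = deduplicate _≟ᴱ_
    (concatMap (λ v → concatMap (edgesBetween v) (allFin n)) (allFin n))

  ∈-allEdges : (e : Edge G) → e ∈ allEdges
  ∈-allEdges e = ∈-deduplicate⁺ _≟ᴱ_ (∈-concatMap⁺ _ (lose (∈-allFin (lo e))
    (∈-concatMap⁺ _ (lose (∈-allFin (hi e)) (∈-edgesBetween e)))))

  allEdges-unique : Unique allEdges
  allEdges-unique = deduplicate-! _≟ᴱ_ _

-- Paths

module _ {G : Graph n} where

  open import Data.List.Membership.DecPropositional (_≟_ {n}) using (_∈?_)

  -- Keeps a property of the steps available after a walk is shortened to a path.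
  Along : Rel (Fin n) ℓ → Walk G v w → Set ℓ
  Along T (_◅_ {i} {j} _ p) = T i j × Along T p
  Along T ε = Lift _ ⊤

  along-star : {T : Rel (Fin n) ℓ} (p : Walk G u v) → Along T p →
               w ∈ walkNodes G p → Star T u w
  along-star ε       _        (here refl) = ε
  along-star (_ ◅ _) _        (here refl) = ε
  along-star (_ ◅ p) (t , ts) (there w∈)  = t ◅ along-star p ts w∈

  along-all : {T : Rel (Fin n) ℓ} {Q : Edge G → Set ℓ′} →
              (∀ {i j} (a : Adj G i j) → T i j → Q (edge G a)) →
              (p : Walk G u v) → Along T p → All Q (walkEdges G p)
  along-all f ε       _        = []
  along-all f (a ◅ p) (t , ts) = f a t ∷ along-all f p ts

  source∈ : (p : Walk G u v) → u ∈ walkNodes G p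
  source∈ ε       = here refl
  source∈ (_ ◅ _) = here refl

  target∈ : (p : Walk G u v) → v ∈ walkNodes G p
  target∈ ε       = here refl
  target∈ (_ ◅ p) = there (target∈ p)

  Within : List (Fin n) → Rel (Fin n) 0ℓ
  Within S i j = Adj G i j × i ∈ S × j ∈ S

  within-sym : ∀ {S i j} → Within S i j → Within S j i
  within-sym (a , i∈ , j∈) = Graph.adj-sym G a , j∈ , i∈

  nodes⇒within : ∀ {S} (p : Walk G u v) → walkNodes G p ⊆ S → Along (Within S) p
  nodes⇒within ε       _  = lift tt
  nodes⇒within (a ◅ p) p⊆ =
    (a , p⊆ (here refl) , p⊆ (there (source∈ p))) , nodes⇒within p (p⊆ ∘ there)

  within⇒nodes : ∀ {S} (p : Walk G u v) → Along (Within S) p → u ∈ S → walkNodes G p ⊆ S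
  within⇒nodes ε       _                     u∈ (here refl) = u∈
  within⇒nodes (_ ◅ _) _                     u∈ (here refl) = u∈
  within⇒nodes (_ ◅ p) ((_ , _ , j∈) , ts)   u∈ (there x∈)  = within⇒nodes p ts j∈ x∈

  -- Both nodes are reached from the start of the walk within its node set.
  within-connected : ∀ {a b} (p : Walk G u v) → a ∈ walkNodes G p → b ∈ walkNodes G p →
                     Star (Within (walkNodes G p)) a b
  within-connected p a∈ b∈ =
    Star.reverse within-sym (along-star p within a∈) ◅◅ along-star p within b∈
    where within = nodes⇒within p id

  suffix : {T : Rel (Fin n) ℓ} (P : Path G u v) → Along T (proj₁ P) → w ∈ pathNodes G P →
           Σ[ R ∈ Path G w v ] Along T (proj₁ R)
  suffix P@(ε , _)             ts       (here refl) = P , ts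
  suffix P@(_ ◅ _ , _)         ts       (here refl) = P , ts
  suffix (_ ◅ p , _ ∷ unique)  (_ , ts) (there w∈)  = suffix (p , unique) ts w∈

  -- If the new first node already lies on the path, the suffix from there replaces the loop.
  loopErase : {T : Rel (Fin n) ℓ} → (∀ {i j} → T i j → Adj G i j) →
              Star T u v → Σ[ P ∈ Path G u v ] Along T (proj₁ P)
  loopErase T⊆ ε = (ε , [] ∷ []) , lift tt
  loopErase {u = u} T⊆ (t ◅ ts) with loopErase T⊆ ts
  ... | (p , unique) , along with u ∈? walkNodes G p
  ...   | yes u∈ = suffix (p , unique) along u∈
  ...   | no  u∉ = (T⊆ t ◅ p , ¬Any⇒All¬ _ u∉ ∷ unique) , t , along

  -- The last component yields paths that miss a chosen node: cut before the end of `P`, the prefix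
  -- avoids that end.
  prefix : (P : Path G u v) → w ∈ pathNodes G P →
           Σ[ R ∈ Path G u w ] (pathNodes G R ⊆ pathNodes G P) × (v ∈ pathNodes G R → v ≡ w)
  prefix P@(ε , _)     (here refl) = P , id , λ _ → refl
  prefix (a ◅ p , u≢ ∷ unique) (here refl) = (ε , [] ∷ []) , (λ { (here refl) → here refl }) ,
    λ { (here v≡u) → v≡u }
  prefix {u = u} {v} (a ◅ p , u≢ ∷ unique) (there w∈) with prefix (p , unique) w∈
  ... | (r , r!) , r⊆p , v∈⇒ =
    (a ◅ r , ¬Any⇒All¬ _ (λ u∈ → All¬⇒¬Any u≢ (r⊆p u∈)) ∷ r!) ,
    (λ { (here x≡) → here x≡ ; (there x∈) → there (r⊆p x∈) }) ,
    λ { (here refl) → contradiction (target∈ p) (All¬⇒¬Any u≢) ; (there v∈) → v∈⇒ v∈ }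

  reversePath : (P : Path G u v) → Σ[ R ∈ Path G v u ] (pathNodes G R ⊆ pathNodes G P)
  reversePath (p , _) with loopErase proj₁ (within-connected p (target∈ p) (source∈ p))
  ... | (r , r!) , along = (r , r!) , within⇒nodes r along (target∈ p)

  -- The last two components serve cut-vertices: an end of `P` that lies on every path from `u` to
  -- `v` must be `u` or `v` itself.
  subpath : ∀ {p q} (P : Path G p q) → u ∈ pathNodes G P → v ∈ pathNodes G P →
            Σ[ R ∈ Path G u v ] (pathNodes G R ⊆ pathNodes G P) ×
              (p ∈ pathNodes G R → p ≡ u ⊎ p ≡ v) × (q ∈ pathNodes G R → q ≡ u ⊎ q ≡ v)
  subpath P@(ε , _) (here refl) (here refl) = P , id , (λ _ → inj₁ refl) , λ _ → inj₁ refl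
  subpath P@(_ ◅ _ , _) (here refl) v∈ with prefix P v∈
  ... | R , R⊆P , q∈⇒ = R , R⊆P , (λ _ → inj₁ refl) , inj₂ ∘ q∈⇒
  subpath P@(_ ◅ _ , _) u∈@(there _) (here refl) with prefix P u∈
  ... | R , R⊆P , q∈⇒ with reversePath R
  ...   | R′ , R′⊆R = R′ , R⊆P ∘ R′⊆R , (λ _ → inj₂ refl) , inj₁ ∘ q∈⇒ ∘ R′⊆R
  subpath (a ◅ p , p≢ ∷ unique) (there u∈) (there v∈) with subpath (p , unique) u∈ v∈
  ... | R , R⊆P , _ , q∈⇒ =
    R , there ∘ R⊆P , (λ p∈R → contradiction (R⊆P p∈R) (All¬⇒¬Any p≢)) , q∈⇒

-- Decompositions

-- The lifted multicuts are the edge sets between the classes of these.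
record Decomposition (G : Graph n) : Set₁ where
  field
    _~_           : Rel (Fin n) 0ℓ
    _~?_          : Decidable _~_
    isEquivalence : IsEquivalence _~_
    connected     : ∀ {i j} → i ~ j → Star (λ a b → Adj G a b × a ~ b) i j

  module ~ = IsEquivalence isEquivalence

module _ (G : Graph n) (π : Fin n → Fin n) (S : List (Fin n)) where

  open import Data.List.Membership.DecPropositional (_≟_ {n}) using (_∈?_)

  -- The classes are the fibres of `π`, with all fibres over `S` united into one. Later `π` is the
  -- identity or the contraction of an edge.
  Merged : Rel (Fin n) 0ℓ
  Merged i j = π i ≡ π j ⊎ (π i ∈ S × π j ∈ S)

  merge : (∀ {i j} → Merged i j → Star (λ a b → Adj G a b × Merged a b) i j) → Decomposition G
  merge connected = record
    { _~_           = Merged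
    ; _~?_          = λ i j → (π i ≟ π j) ⊎-dec ((π i ∈? S) ×-dec (π j ∈? S))
    ; isEquivalence = record
      { refl  = inj₁ refl
      ; sym   = λ { (inj₁ p) → inj₁ (sym p) ; (inj₂ (p , q)) → inj₂ (q , p) }
      ; trans = λ
        { (inj₁ p)       (inj₁ q)       → inj₁ (trans p q)
        ; (inj₁ p)       (inj₂ (q , r)) → inj₂ (subst (_∈ S) (sym p) q , r)
        ; (inj₂ (p , q)) (inj₁ r)       → inj₂ (p , subst (_∈ S) r q)
        ; (inj₂ (p , _)) (inj₂ (_ , q)) → inj₂ (p , q)
        }
      }
    ; connected     = connected
    }

-- Its multicut is the all-ones point.
discrete : (G : Graph n) → Decomposition G
discrete G = merge G id [] λ { (inj₁ refl) → ε }

contract : {G : Graph n} → Walk G u v → Decomposition G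
contract {G = G} p = merge G id (walkNodes G p) λ
  { (inj₁ refl)      → ε
  ; (inj₂ (i∈ , j∈)) → Star.map (λ (a , ab∈) → a , inj₂ ab∈) (within-connected p i∈ j∈)
  }

-- Contract a path from `r` to `s`. If it passes through `t`, its prefix up to `t` misses `s` and is
-- contracted instead.
separateNeighbours : (G : Graph n) → Connected G → ∀ {r s t} → r ≢ s → r ≢ t → s ≢ t →
  let open Decomposition in
  Σ[ D ∈ Decomposition G ] ((_~_ D r s × ¬ _~_ D r t) ⊎ (¬ _~_ D r s × _~_ D r t))
separateNeighbours {n} G conn {r} {s} {t} r≢s r≢t s≢t
  with P@(p , _) , _ ← loopErase id (conn r s) | t ∈? walkNodes G p
  where open import Data.List.Membership.DecPropositional (_≟_ {n}) using (_∈?_)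
... | no t∉ = contract p , inj₁ (inj₂ (source∈ p , target∈ p) ,
  λ { (inj₁ r≡t) → r≢t r≡t ; (inj₂ (_ , t∈)) → t∉ t∈ })
... | yes t∈ with (r′ , _) , _ , s∈⇒ ← prefix P t∈ = contract r′ , inj₂
  ((λ { (inj₁ r≡s) → r≢s r≡s ; (inj₂ (_ , s∈)) → s≢t (s∈⇒ s∈) }) , inj₂ (source∈ r′ , target∈ r′))

-- Ordered fields

module OrderedFieldProperties {c ℓ₁ ℓ₂ ℓ₃} (K : OrderedField c ℓ₁ ℓ₂ ℓ₃) where

  open OrderedField K hiding (zero) renaming (refl to ≈-refl; sym to ≈-sym; trans to ≈-trans)
  open CommutativeRing commutativeRing using (ring; semiring)
  open import Algebra.Apartness.Properties.HeytingCommutativeRing heytingCommutativeRing public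
    using (1#0; x-0≈x; invertibleˡ⇒#; #-congˡ; #-congʳ)
  open import Algebra.Properties.Ring ring
    using (-‿distribˡ-*; -‿distribʳ-*; -‿involutive)
  open import Algebra.Properties.Semiring.Sum semiring
  open import Relation.Binary.Reasoning.Setoid setoid
  open IsStrictPartialOrder isStrictPartialOrder
    using (<-respˡ-≈; <-respʳ-≈)
    renaming (irrefl to <-irrefl; trans to <-trans; asym to <-asym)

  -- Follows from tightness of the apartness. It allows equalities to be derived from doubly negated
  -- facts, such as the existence of minimal cuts.
  ≈-stable : ∀ {x y} → ¬ ¬ (x ≈ y) → x ≈ y
  ≈-stable {x} {y} ¬¬x≈y = proj₁ (tight x y) λ x#y → ¬¬x≈y λ x≈y → proj₂ (tight x y) x≈y x#y

  1≉0 : ¬ (1# ≈ 0#)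
  1≉0 1≈0 = proj₂ (tight 1# 0#) 1≈0 1#0

  *-cancel-# : ∀ {x a} → x # 0# → a * x ≈ 0# → a ≈ 0#
  *-cancel-# {x} {a} x#0 ax≈0 with x⁻¹ , _ , xx⁻¹≈1 ← #⇒invertible x#0 = begin
    a                    ≈⟨ *-identityʳ a ⟨
    a * 1#               ≈⟨ *-congˡ xx⁻¹≈1 ⟨
    a * ((x - 0#) * x⁻¹) ≈⟨ *-congˡ (*-congʳ (x-0≈x x)) ⟩
    a * (x * x⁻¹)        ≈⟨ *-assoc a x x⁻¹ ⟨
    a * x * x⁻¹          ≈⟨ *-congʳ ax≈0 ⟩
    0# * x⁻¹             ≈⟨ zeroˡ x⁻¹ ⟩
    0#                   ∎

  x-x≈0 : ∀ x → x - x ≈ 0#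
  x-x≈0 = -‿inverseʳ

  -- Order

  -- If `1#` were negative, `- 1#` would be positive and so would its square, which is `1#`.
  0<1 : 0# <ᴷ 1#
  0<1 with #⇒<⊎> 1#0
  ... | inj₂ 0<1 = 0<1
  ... | inj₁ 1<0 = contradiction (<-respʳ-≈ -1*-1≈1 (*-pos 0<-1 0<-1)) (<-asym 1<0)
    where
    0<-1 : 0# <ᴷ - 1#
    0<-1 = <-respˡ-≈ (x-x≈0 1#) (<-respʳ-≈ (+-identityˡ _) (+-monoˡ-< (- 1#) 1<0))
    -1*-1≈1 : - 1# * - 1# ≈ 1#
    -1*-1≈1 = begin
      - 1# * - 1#     ≈⟨ -‿distribˡ-* 1# (- 1#) ⟨
      - (1# * - 1#)   ≈⟨ -‿cong (*-identityˡ (- 1#)) ⟩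
      - - 1#          ≈⟨ -‿involutive 1# ⟩
      1#              ∎

  ≤-reflexive : ∀ {x y} → x ≈ y → x ≤ᴷ y
  ≤-reflexive x≈y = <-irrefl (≈-sym x≈y)

  ≤-resp-≈ : ∀ {x x′ y y′} → x ≈ x′ → y ≈ y′ → x ≤ᴷ y → x′ ≤ᴷ y′
  ≤-resp-≈ x≈ y≈ x≤y y<x = x≤y (<-respˡ-≈ (≈-sym y≈) (<-respʳ-≈ (≈-sym x≈) y<x))

  1≰0 : ¬ (1# ≤ᴷ 0#)
  1≰0 1≤0 = 1≤0 0<1

  0≤1 : 0# ≤ᴷ 1#
  0≤1 = <-asym 0<1

  <-cancelʳ : ∀ {x y} z → x + z <ᴷ y + z → x <ᴷ y
  <-cancelʳ z x+z<y+z = <-respˡ-≈ (undo _) (<-respʳ-≈ (undo _) (+-monoˡ-< (- z) x+z<y+z))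
    where
    undo : ∀ x → x + z - z ≈ x
    undo x = ≈-trans (+-assoc x z (- z)) (≈-trans (+-congˡ (x-x≈0 z)) (+-identityʳ x))

  -- Cotransitivity of the apartness replaces the comparison of arbitrary scalars, which need not be
  -- decidable.
  <-cotrans : ∀ {x y} → x <ᴷ y → ∀ z → x <ᴷ z ⊎ z <ᴷ y
  <-cotrans x<y z with #-cotrans (<⇒# x<y) z
  ... | inj₁ x#z with #⇒<⊎> x#z
  ...   | inj₁ x<z = inj₁ x<z
  ...   | inj₂ z<x = inj₂ (<-trans z<x x<y)
  <-cotrans x<y z | inj₂ z#y with #⇒<⊎> z#y
  ...   | inj₁ z<y = inj₂ z<y
  ...   | inj₂ y<z = inj₁ (<-trans x<y y<z)

  +-nonneg : ∀ {x y} → 0# ≤ᴷ x → 0# ≤ᴷ y → 0# ≤ᴷ x + y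
  +-nonneg {x} {y} 0≤x 0≤y x+y<0 with <-cotrans x+y<0 y
  ... | inj₂ y<0   = 0≤y y<0
  ... | inj₁ x+y<y = 0≤x (<-cancelʳ y (<-respʳ-≈ (≈-sym (+-identityˡ y)) x+y<y))

  x≤x+y : ∀ {x y} → 0# ≤ᴷ y → x ≤ᴷ x + y
  x≤x+y {x} {y} 0≤y x+y<x =
    0≤y (<-cancelʳ x (<-respˡ-≈ (+-comm x y) (<-respʳ-≈ (≈-sym (+-identityˡ x)) x+y<x)))

  x≤y+x : ∀ {x y} → 0# ≤ᴷ y → x ≤ᴷ y + x
  x≤y+x 0≤y = ≤-resp-≈ ≈-refl (+-comm _ _) (x≤x+y 0≤y)

  sum-nonneg : ∀ {k} (f : Fin k → Carrier) → (∀ j → 0# ≤ᴷ f j) → 0# ≤ᴷ sum f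
  sum-nonneg {ℕ.zero}  f 0≤f = ≤-reflexive ≈-refl
  sum-nonneg {ℕ.suc k} f 0≤f = +-nonneg (0≤f zero) (sum-nonneg (f ∘ suc) (0≤f ∘ suc))

  x+y≈0⇒x≈0 : ∀ {x y} → 0# ≤ᴷ x → 0# ≤ᴷ y → x + y ≈ 0# → x ≈ 0#
  x+y≈0⇒x≈0 {x} {y} 0≤x 0≤y x+y≈0 = proj₁ (tight x 0#) λ x#0 → case (#⇒<⊎> x#0)
    where
    case : x <ᴷ 0# ⊎ 0# <ᴷ x → ⊥
    case (inj₁ x<0) = 0≤x x<0
    case (inj₂ 0<x) = 0≤y (<-respˡ-≈ (+-identityˡ y) (<-respʳ-≈ x+y≈0 (+-monoˡ-< y 0<x)))

  sum≈0⇒≈0 : ∀ {k} (f : Fin k → Carrier) → (∀ j → 0# ≤ᴷ f j) → sum f ≈ 0# → ∀ j → f j ≈ 0#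
  sum≈0⇒≈0 f 0≤f Σf≈0 zero    = x+y≈0⇒x≈0 (0≤f zero) (sum-nonneg (f ∘ suc) (0≤f ∘ suc)) Σf≈0
  sum≈0⇒≈0 f 0≤f Σf≈0 (suc j) = sum≈0⇒≈0 (f ∘ suc) (0≤f ∘ suc)
    (x+y≈0⇒x≈0 (sum-nonneg (f ∘ suc) (0≤f ∘ suc)) (0≤f zero) (≈-trans (+-comm _ _) Σf≈0)) j

  Binary : Carrier → Set ℓ₁
  Binary x = x ≈ 0# ⊎ x ≈ 1#

  binary-nonneg : ∀ {x} → Binary x → 0# ≤ᴷ x
  binary-nonneg (inj₁ x≈0) = ≤-reflexive (≈-sym x≈0)
  binary-nonneg (inj₂ x≈1) = ≤-resp-≈ ≈-refl (≈-sym x≈1) 0≤1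

  binary-1- : ∀ {x} → Binary x → Binary (1# - x)
  binary-1- (inj₁ x≈0) = inj₂ (≈-trans (+-congˡ (-‿cong x≈0)) (x-0≈x 1#))
  binary-1- (inj₂ x≈1) = inj₁ (≈-trans (+-congˡ (-‿cong x≈1)) (x-x≈0 1#))

  module _ {a} {A : Set a} (f : A → Carrier) where

    listSum : List A → Carrier
    listSum xs = foldr _+_ 0# (map f xs)

    listSum≈0 : ∀ {xs} → All (λ x → f x ≈ 0#) xs → listSum xs ≈ 0#
    listSum≈0 []         = ≈-refl
    listSum≈0 (px ∷ pxs) = ≈-trans (+-cong px (listSum≈0 pxs)) (+-identityˡ 0#)

    module _ (binary : ∀ x → Binary (f x)) where

      listSum-nonneg : ∀ xs → 0# ≤ᴷ listSum xs
      listSum-nonneg []       = ≤-reflexive ≈-refl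
      listSum-nonneg (x ∷ xs) = +-nonneg (binary-nonneg (binary x)) (listSum-nonneg xs)

      1≤listSum : ∀ {xs} → Any (λ x → f x ≈ 1#) xs → 1# ≤ᴷ listSum xs
      1≤listSum {_ ∷ xs} (here fx≈1) =
        ≤-resp-≈ ≈-refl (+-congʳ (≈-sym fx≈1)) (x≤x+y (listSum-nonneg xs))
      1≤listSum {x ∷ xs} (there any) <1 with <-cotrans <1 (listSum xs)
      ... | inj₁ x+Σ<Σ = x≤y+x (binary-nonneg (binary x)) x+Σ<Σ
      ... | inj₂ Σ<1   = 1≤listSum any Σ<1

      all-0⊎any-1 : ∀ xs → All (λ x → f x ≈ 0#) xs ⊎ Any (λ x → f x ≈ 1#) xs
      all-0⊎any-1 []       = inj₁ []
      all-0⊎any-1 (x ∷ xs) with binary x | all-0⊎any-1 xs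
      ... | inj₂ fx≈1 | _        = inj₂ (here fx≈1)
      ... | inj₁ fx≈0 | inj₁ all = inj₁ (fx≈0 ∷ all)
      ... | inj₁ _    | inj₂ any = inj₂ (there any)

      -- For binary values, such an inequality fails only if the left side is one and all terms on
      -- the right are zero. The cycle, path and cut inequalities are verified in this way.
      binary≤listSum : ∀ {y xs} → Binary y →
                     (y ≈ 1# → ¬ All (λ x → f x ≈ 0#) xs) → y ≤ᴷ listSum xs
      binary≤listSum {xs = xs} (inj₁ y≈0) _ = ≤-resp-≈ (≈-sym y≈0) ≈-refl (listSum-nonneg xs)
      binary≤listSum {xs = xs} (inj₂ y≈1) ¬all with all-0⊎any-1 xs
      ... | inj₁ all = contradiction all (¬all y≈1)
      ... | inj₂ any = ≤-resp-≈ (≈-sym y≈1) ≈-refl (1≤listSum any)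

  1≰listSum : ∀ {a} {A : Set a} (f : A → Carrier) {y xs} → y ≈ 1# →
            All (λ x → f x ≈ 0#) xs → ¬ (y ≤ᴷ listSum f xs)
  1≰listSum f y≈1 all y≤Σ = 1≰0 (≤-resp-≈ y≈1 (listSum≈0 f all) y≤Σ)

  -- Linear algebra

  sum≈0 : ∀ {k} {f : Fin k → Carrier} → (∀ j → f j ≈ 0#) → sum f ≈ 0#
  sum≈0 {k} f≈0 = ≈-trans (sum-cong-≋ f≈0) (sum-replicate-zero k)

  sum-single : ∀ {k} (f : Fin k → Carrier) i → (∀ j → j ≢ i → f j ≈ 0#) → sum f ≈ f i
  sum-single {ℕ.suc k} f i f≈0 = begin
    sum f                          ≈⟨ sum-remove f ⟩
    f i + sum (f ∘ punchIn i)      ≈⟨ +-congˡ (sum≈0 λ j → f≈0 (punchIn i j) (punchInᵢ≢i i j)) ⟩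
    f i + 0#                       ≈⟨ +-identityʳ (f i) ⟩
    f i                            ∎

  LinearlyIndependent : ∀ {k m} → (Fin k → Fin m → Carrier) → Set _
  LinearlyIndependent {k} A =
    ∀ (α : Fin k → Carrier) → (∀ i → sum (λ j → α j * A j i) ≈ 0#) → ∀ j → α j ≈ 0#

  module _ {k} (β : Fin k → Carrier) (a : Fin (ℕ.suc k) → Carrier) (p : Fin (ℕ.suc k)) where

    -- The coefficients β of the rows reduced by the pivot row p become
    -- coefficients of the original rows.
    liftCoefficients : Fin (ℕ.suc k) → Carrier
    liftCoefficients =
      insertAt (λ j → β j * a p) p (sum (λ j → - (β j * a (punchIn p j))))

    -- The reduction cross-multiplies instead of dividing: row `punchIn p j` is scaled by the pivot
    -- entry `a p`, and the pivot row times `a (punchIn p j)` is subtracted.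
    sum-liftCoefficients : ∀ (M : Fin (ℕ.suc k) → Carrier) →
      sum (λ j → liftCoefficients j * M j) ≈
      sum (λ j → β j * (a p * M (punchIn p j) - a (punchIn p j) * M p))
    sum-liftCoefficients M = begin
      sum (λ j → α j * M j)
        ≈⟨ sum-remove (λ j → α j * M j) ⟩
      α p * M p + sum (λ j → α (punchIn p j) * M (punchIn p j))
        ≈⟨ +-cong (*-congʳ (reflexive (insertAt-lookup _ p _)))
                  (sum-cong-≋ λ j → *-congʳ (reflexive (insertAt-punchIn _ p _ j))) ⟩
      sum (λ j → - (β j * a′ j)) * M p + sum (λ j → β j * a p * M′ j)
        ≈⟨ +-congʳ (*-distribʳ-sum (M p) (λ j → - (β j * a′ j))) ⟩
      sum (λ j → - (β j * a′ j) * M p) + sum (λ j → β j * a p * M′ j)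
        ≈⟨ ∑-distrib-+ (λ j → - (β j * a′ j) * M p) (λ j → β j * a p * M′ j) ⟨
      sum (λ j → - (β j * a′ j) * M p + β j * a p * M′ j)
        ≈⟨ sum-cong-≋ term ⟩
      sum (λ j → β j * (a p * M′ j - a′ j * M p)) ∎
      where
      α = liftCoefficients
      a′ = a ∘ punchIn p
      M′ = M ∘ punchIn p
      term : ∀ j → - (β j * a′ j) * M p + β j * a p * M′ j ≈ β j * (a p * M′ j - a′ j * M p)
      term j = begin
        - (β j * a′ j) * M p + β j * a p * M′ j       ≈⟨ +-comm _ _ ⟩
        β j * a p * M′ j + - (β j * a′ j) * M p       ≈⟨ +-cong (*-assoc _ _ _) (≈-sym (-‿distribˡ-* _ _)) ⟩
        β j * (a p * M′ j) + - (β j * a′ j * M p)     ≈⟨ +-congˡ (-‿cong (*-assoc _ _ _)) ⟩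
        β j * (a p * M′ j) + - (β j * (a′ j * M p))   ≈⟨ +-congˡ (-‿distribʳ-* _ _) ⟩
        β j * (a p * M′ j) + β j * - (a′ j * M p)     ≈⟨ distribˡ _ _ _ ⟨
        β j * (a p * M′ j - a′ j * M p)               ∎

  -- Gaussian elimination; since the conclusion is negative, no decision
  -- procedure for pivots is needed.
  independent⇒≤ : ∀ {k m} (A : Fin k → Fin m → Carrier) → LinearlyIndependent A → k ℕ.≤ m
  independent⇒≤ {k} {m} A ind with k ℕ.≤? m
  ... | yes k≤m = k≤m
  ... | no  k≰m = ⊥-elim (dependent A (ℕ.≰⇒> k≰m) ind)
    where
    dependent : ∀ {k m} (A : Fin k → Fin m → Carrier) → m ℕ.< k → ¬ LinearlyIndependent A
    dependent {ℕ.suc k} {ℕ.zero}  A _          ind = 1≉0 (ind (λ _ → 1#) (λ ()) zero)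
    dependent {ℕ.suc k} {ℕ.suc m} A (s≤s m<k) ind =
      -- By `noPivot` the first column vanishes, so the rows remain independent without it, and
      -- induction on the number of columns applies.
      dependent (λ j i → A j (suc i)) (ℕ.m<n⇒m<1+n m<k) λ α Σ≈0 → ind α λ
        { zero    → sum≈0 {ℕ.suc k} λ j → ≈-trans (*-congˡ (proj₁ (tight _ _) (noPivot j))) (zeroʳ (α j))
        ; (suc i) → Σ≈0 i
        }
      where
      noPivot : ∀ p → ¬ (A p zero # 0#)
      -- A pivot would give `k` independent reduced rows in the remaining `m` columns, although
      -- `m < k`.
      noPivot p Ap#0 = dependent B m<k λ β ΣβB≈0 j → *-cancel-# Ap#0 (begin
        β j * a p                          ≈⟨ reflexive (insertAt-punchIn _ p _ j) ⟨
        liftCoefficients β a p (punchIn p j) ≈⟨ ind (liftCoefficients β a p) (λ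
          { zero    → ≈-trans (sum-liftCoefficients β a p a) (sum≈0 {k} λ j →
              ≈-trans (*-congˡ (≈-trans (+-congʳ (*-comm _ _)) (x-x≈0 _))) (zeroʳ (β j)))
          ; (suc i) → ≈-trans (sum-liftCoefficients β a p (λ j → A j (suc i))) (ΣβB≈0 i)
          }) (punchIn p j) ⟩
        0#                                 ∎)
        where
        a = λ j → A j zero
        B = λ j i → a p * A (punchIn p j) (suc i) - a (punchIn p j) * A p (suc i)

-- Polytopes

module PolytopeProperties {c ℓ₁ ℓ₂ ℓ₃} (K : OrderedField c ℓ₁ ℓ₂ ℓ₃) (I : Set) where

  open OrderedField K hiding (zero) renaming (refl to ≈-refl; sym to ≈-sym; trans to ≈-trans)
  open OrderedFieldProperties K
  open Polyhedra K I
  open CommutativeRing commutativeRing using (ring; semiring)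
  open import Algebra.Properties.Ring ring
    using (-‿distribˡ-*; -‿distribʳ-*; -1*x≈-x)
  open import Algebra.Properties.Semiring.Sum semiring
  open import Relation.Binary.Reasoning.Setoid setoid

  -- Quantifying over all p equal to the combination includes congruence.
  Linear : (Point → Carrier) → Set _
  Linear ψ = ∀ {k} (α : Fin k → Carrier) (q : Fin k → Point) {p} →
    (∀ i → p i ≈ sum (λ j → α j * q j i)) → ψ p ≈ sum (λ j → α j * ψ (q j))

  coordinate-linear : ∀ i → Linear (λ x → x i)
  coordinate-linear i α q p≈ = p≈ i

  sum-*-minus : ∀ {k} (α x y : Fin k → Carrier) →
    sum (λ j → α j * (x j - y j)) ≈ sum (λ j → α j * x j) - sum (λ j → α j * y j)
  sum-*-minus {k} α x y = begin
    sum (λ j → α j * (x j - y j))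
      ≈⟨ sum-cong-≋ {k} (λ j → ≈-trans (distribˡ _ _ _)
           (+-congˡ (≈-sym (≈-trans (-1*x≈-x _) (-‿distribʳ-* _ _))))) ⟩
    sum (λ j → α j * x j + - 1# * (α j * y j))
      ≈⟨ ∑-distrib-+ (λ j → α j * x j) (λ j → - 1# * (α j * y j)) ⟩
    sum (λ j → α j * x j) + sum (λ j → - 1# * (α j * y j))
      ≈⟨ +-congˡ (*-distribˡ-sum (- 1#) (λ j → α j * y j)) ⟨
    sum (λ j → α j * x j) + - 1# * sum (λ j → α j * y j)
      ≈⟨ +-congˡ (-1*x≈-x _) ⟩
    sum (λ j → α j * x j) - sum (λ j → α j * y j) ∎

  minus-linear : ∀ {ψ φ} → Linear ψ → Linear φ → Linear (λ x → ψ x - φ x)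
  minus-linear {ψ} {φ} ψ-linear φ-linear α q p≈ =
    ≈-trans (+-cong (ψ-linear α q p≈) (-‿cong (φ-linear α q p≈)))
          (≈-sym (sum-*-minus α (ψ ∘ q) (φ ∘ q)))

  affinelyIndependent-tail : ∀ {k} {p : Point} {q : Fin k → Point} →
                             AffinelyIndependent (p ∷ᵛ q) → AffinelyIndependent q
  affinelyIndependent-tail {p = p} ind α Σα≈0 Σαq≈0 j =
    ind (0# ∷ᵛ α) (≈-trans (+-identityˡ _) Σα≈0)
      (λ i → ≈-trans (+-congʳ (zeroˡ (p i))) (≈-trans (+-identityˡ _) (Σαq≈0 i))) (suc j)

  module _ {m} (to : Fin m → I) (from : I → Fin m) (to∘from : ∀ i → to (from i) ≡ i) where

    -- A constant coordinate `1#` turns affine into linear independence, in `m + 1` coordinates.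
    affinelyIndependent⇒≤ : ∀ {k} (q : Fin k → Point) → AffinelyIndependent q → k ℕ.≤ ℕ.suc m
    affinelyIndependent⇒≤ {k} q ind = independent⇒≤ (λ j → 1# ∷ᵛ (q j ∘ to)) λ α Σ≈0 →
      ind α (≈-trans (sum-cong-≋ {k} λ j → ≈-sym (*-identityʳ (α j))) (Σ≈0 zero))
        λ i → subst (λ i → sum (λ j → α j * q j i) ≈ 0#) (to∘from i) (Σ≈0 (suc (from i)))

    -- On the hyperplane x e = 0, the coordinate e is free to hold the
    -- constant 1 that turns affine into linear independence.
    affinelyIndependent-face⇒≤ : ∀ {k} (e : I) (q : Fin k → Point) → (∀ j → q j e ≈ 0#) →
                                 AffinelyIndependent q → k ℕ.≤ m
    affinelyIndependent-face⇒≤ {k} e q qe≈0 ind = independent⇒≤ A λ α Σ≈0 → ind α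
      (≈-trans (sum-cong-≋ {k} λ j → ≈-sym (≈-trans (*-congˡ (at-e j)) (*-identityʳ (α j)))) (Σ≈0 (from e)))
      λ i → case α Σ≈0 (from i ≟ from e)
      where
      A : Fin k → Fin m → Carrier
      A j i with i ≟ from e
      ... | yes _ = 1#
      ... | no  _ = q j (to i)
      at-e : ∀ j → A j (from e) ≈ 1#
      at-e j with from e ≟ from e
      ... | yes _ = ≈-refl
      ... | no ¬p = contradiction refl ¬p
      at-≢e : ∀ {i} j → i ≢ from e → A j i ≈ q j (to i)
      at-≢e {i} j i≢e with i ≟ from e
      ... | yes p = contradiction p i≢e
      ... | no  _ = ≈-refl
      case : ∀ {i} α → (∀ i → sum (λ j → α j * A j i) ≈ 0#) → Dec (from i ≡ from e) →
             sum (λ j → α j * q j i) ≈ 0#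
      case {i} α Σ≈0 (yes p) with refl ← trans (sym (to∘from i)) (trans (cong to p) (to∘from e)) =
        sum≈0 {k} λ j → ≈-trans (*-congˡ (qe≈0 j)) (zeroʳ (α j))
      case {i} α Σ≈0 (no ¬p) = ≈-trans
        (sum-cong-≋ {k} λ j → *-congˡ (≈-trans (reflexive (cong (q j) (sym (to∘from i))))
                                             (≈-sym (at-≢e j ¬p))))
        (Σ≈0 (from i))

    module _ (rank : Fin m → ℕ) {ones : Point} (ones≈1 : ∀ i → ones i ≈ 1#)
             (q : Fin m → Point) (diagonal : ∀ j → q j (to j) ≈ 0#)
             (offDiagonal : ∀ i j → j ≢ i → q j (to i) ≈ 1# ⊎ rank i ℕ.< rank j) where

      -- The vectors 1 − q j are unitriangular.
      unitriangular⇒affinelyIndependent : AffinelyIndependent (ones ∷ᵛ q)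
      unitriangular⇒affinelyIndependent α Σα≈0 Σαq≈0 = λ { zero → α₀≈0 ; (suc j) → αₛ≈0 j }
        where
        αₛ = α ∘ suc

        -- Subtracting the relation at coordinate `i` from the one for the sum of the coefficients
        -- cancels the all-ones point.
        Σα[1-q]≈0 : ∀ i → sum (λ j → αₛ j * (1# - q j i)) ≈ 0#
        Σα[1-q]≈0 i = begin
          sum (λ j → αₛ j * (1# - q j i))
            ≈⟨ +-identityˡ _ ⟨
          0# + sum (λ j → αₛ j * (1# - q j i))
            ≈⟨ +-congʳ (≈-trans (*-congˡ (≈-trans (+-congˡ (-‿cong (ones≈1 i))) (x-x≈0 1#))) (zeroʳ _)) ⟨
          sum (λ j → α j * (1# - (ones ∷ᵛ q) j i))
            ≈⟨ sum-*-minus α (const 1#) (λ j → (ones ∷ᵛ q) j i) ⟩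
          sum (λ j → α j * 1#) - sum (λ j → α j * (ones ∷ᵛ q) j i)
            ≈⟨ +-cong (≈-trans (sum-cong-≋ {ℕ.suc m} (*-identityʳ ∘ α)) Σα≈0) (-‿cong (Σαq≈0 i)) ⟩
          0# - 0#
            ≈⟨ x-x≈0 0# ⟩
          0# ∎

        -- Row `j` contributes to column `i` only if `j` is `i` or has larger rank, so the
        -- coefficients vanish from the largest rank downwards.
        αₛ≈0-acc : ∀ {i} → Acc (λ i j → rank j ℕ.< rank i) i → αₛ i ≈ 0#
        αₛ≈0-acc {i} (acc rec) = begin
          αₛ i                                ≈⟨ *-identityʳ _ ⟨
          αₛ i * 1#                           ≈⟨ *-congˡ (≈-trans (+-congˡ (-‿cong (diagonal i))) (x-0≈x 1#)) ⟨
          αₛ i * (1# - q i (to i))            ≈⟨ sum-single (λ j → αₛ j * (1# - q j (to i))) i others ⟨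
          sum (λ j → αₛ j * (1# - q j (to i))) ≈⟨ Σα[1-q]≈0 (to i) ⟩
          0#                                  ∎
          where
          others : ∀ j → j ≢ i → αₛ j * (1# - q j (to i)) ≈ 0#
          others j j≢i with offDiagonal i j j≢i
          ... | inj₁ q≈1 = ≈-trans (*-congˡ (≈-trans (+-congˡ (-‿cong q≈1)) (x-x≈0 1#))) (zeroʳ _)
          ... | inj₂ i<j = ≈-trans (*-congʳ (αₛ≈0-acc (rec i<j))) (zeroˡ _)

        αₛ≈0 : ∀ i → αₛ i ≈ 0#
        αₛ≈0 i = αₛ≈0-acc (spo-noetherian {_⊏_ = λ i j → rank i ℕ.< rank j}
          (On.isStrictPartialOrder rank ℕ.<-isStrictPartialOrder) i)

        α₀≈0 : α zero ≈ 0#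
        α₀≈0 = ≈-trans (≈-sym (≈-trans (+-congˡ (sum≈0 {m} αₛ≈0)) (+-identityʳ _))) Σα≈0

  module _ {ℓ} {X : Pred Point ℓ} where

    ⊆-conv : ∀ {x} → X x → Conv X x
    ⊆-conv {x} x∈X = record
      { size        = 1
      ; weight      = const 1#
      ; point       = const x
      ; point∈X     = const x∈X
      ; nonneg      = const 0≤1
      ; total       = +-identityʳ 1#
      ; combination = λ i → ≈-sym (≈-trans (+-identityʳ _) (*-identityˡ _))
      }

    module _ (binary : ∀ {x} → X x → ∀ i → Binary (x i)) (e : I) where

      private
        module _ {x : Point} (c : Conv X x) where

          open Conv c

          term-nonneg : ∀ j → 0# ≤ᴷ weight j * point j e
          term-nonneg j with binary (point∈X j) e
          ... | inj₁ x≈0 = ≤-reflexive (≈-sym (≈-trans (*-congˡ x≈0) (zeroʳ _)))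
          ... | inj₂ x≈1 = ≤-resp-≈ ≈-refl (≈-sym (≈-trans (*-congˡ x≈1) (*-identityʳ _))) (nonneg j)

      conv-nonneg : ∀ {x} → Conv X x → 0# ≤ᴷ x e
      conv-nonneg c = ≤-resp-≈ ≈-refl (≈-sym (combination e)) (sum-nonneg _ (term-nonneg c))
        where open Conv c

      -- A linear equation valid for all points of X in the face is valid
      -- on the face, since only those points can have nonzero weight.
      face-vanishing : ∀ {ψ} → Linear ψ → (∀ {x} → X x → x e ≈ 0# → ψ x ≈ 0#) →
                       ∀ {x} → Conv X x → x e ≈ 0# → ψ x ≈ 0#
      face-vanishing {ψ} ψ-linear ψ≈0 {x} c xe≈0 =
        ≈-trans (ψ-linear weight point combination) (sum≈0 {size} term≈0)
        where
        open Conv c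
        term≈0 : ∀ j → weight j * ψ (point j) ≈ 0#
        term≈0 j with binary (point∈X j) e
        ... | inj₁ x≈0 = ≈-trans (*-congˡ (ψ≈0 (point∈X j) x≈0)) (zeroʳ _)
        ... | inj₂ x≈1 = ≈-trans (*-congʳ (begin
          weight j             ≈⟨ *-identityʳ _ ⟨
          weight j * 1#        ≈⟨ *-congˡ x≈1 ⟨
          weight j * point j e ≈⟨ sum≈0⇒≈0 (λ j → weight j * point j e) (term-nonneg c)
                                    (≈-trans (≈-sym (combination e)) xe≈0) j ⟩
          0#                   ∎)) (zeroˡ _)

      -- The face lies in a second hyperplane, and y and z witness that the
      -- two hyperplanes together cut the dimension by two.
      ¬facet : ∀ {ψ} → Linear ψ → (∀ {x} → X x → x e ≈ 0# → ψ x ≈ 0#) →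
               ∀ {y z} → X y → X z → y e ≈ 1# → z e ≈ 1# → ψ y # ψ z →
               ¬ DefinesFacet (Conv X) (const 0#) (λ x → x e)
      ¬facet {ψ} ψ-linear ψ≈0 {y} {z} y∈X z∈X ye≈1 ze≈1 ψy#ψz facet =
        -- These are `2 + F.size` affinely independent points, whereas `P.size` is only
        -- `1 + F.size`.
        ℕ.<-irrefl (sym P.size≡) (P.maximal (y ∷ᵛ z ∷ᵛ F.point)
          (λ { zero → ⊆-conv y∈X ; (suc zero) → ⊆-conv z∈X ; (suc (suc j)) → proj₁ (F.point∈S j) })
          independent)
        where
        open DefinesFacet facet
        open import Algebra.Properties.AbelianGroup ℤ.+-0-abelianGroup
          using () renaming (∙-cancelʳ to ℤ-cancelʳ)
        module F = HasDimension dimF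
        module P where
          open HasDimension dim public
          size≡ : size ≡ ℕ.suc F.size
          size≡ = ℤ.+-injective (ℤ-cancelʳ (ℤ.- 1ℤ) _ _ (ℤ-cancelʳ (ℤ.- 1ℤ) _ _
            (trans (cong (ℤ._- 1ℤ) (sym dimension)) F.dimension)))

        independent : AffinelyIndependent (y ∷ᵛ z ∷ᵛ F.point)
        independent α Σα≈0 Σαq≈0 = λ
          { zero → α₀≈0 ; (suc zero) → α₁≈0 ; (suc (suc j)) → F.independent α′ Σα′≈0 Σα′q≈0 j }
          where
          α₀ = α zero
          α₁ = α (suc zero)
          α′ = λ j → α (suc (suc j))

          -- A linear function that vanishes on the face leaves a relation between the two new
          -- coefficients. For coordinate `e` it reads `α₀ + α₁ ≈ 0#`, and with `ψ` it then forces
          -- `α₀ ≈ 0#`.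
          reduce : ∀ {φ} → Linear φ → (∀ j → φ (F.point j) ≈ 0#) → α₀ * φ y + α₁ * φ z ≈ 0#
          reduce {φ} φ-linear φ≈0 = begin
            α₀ * φ y + α₁ * φ z
              ≈⟨ +-congˡ (≈-trans (+-congˡ (sum≈0 {F.size} λ j → ≈-trans (*-congˡ (φ≈0 j)) (zeroʳ _)))
                                (+-identityʳ _)) ⟨
            sum (λ j → α j * φ ((y ∷ᵛ z ∷ᵛ F.point) j))
              ≈⟨ φ-linear α (y ∷ᵛ z ∷ᵛ F.point) {const 0#} (≈-sym ∘ Σαq≈0) ⟨
            φ (const 0#)
              -- The empty combination shows that a linear function is zero at the origin.
              ≈⟨ φ-linear {0} (λ ()) (λ ()) (λ _ → ≈-refl) ⟩
            0# ∎

          α₀+α₁≈0 : α₀ + α₁ ≈ 0#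
          α₀+α₁≈0 = ≈-trans
            (≈-sym (+-cong (≈-trans (*-congˡ ye≈1) (*-identityʳ _)) (≈-trans (*-congˡ ze≈1) (*-identityʳ _))))
            (reduce (coordinate-linear e) (≈-sym ∘ proj₂ ∘ F.point∈S))

          α₀≈0 : α₀ ≈ 0#
          α₀≈0 = *-cancel-# ψy-ψz#0 (begin
            α₀ * (ψ y - ψ z)            ≈⟨ distribˡ _ _ _ ⟩
            α₀ * ψ y + α₀ * - ψ z       ≈⟨ +-congˡ (≈-trans (≈-sym (-‿distribʳ-* _ _)) (-‿distribˡ-* _ _)) ⟩
            α₀ * ψ y + - α₀ * ψ z       ≈⟨ +-congˡ (*-congʳ -α₀≈α₁) ⟩
            α₀ * ψ y + α₁ * ψ z         ≈⟨ reduce ψ-linear (λ j →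
              face-vanishing ψ-linear ψ≈0 (proj₁ (F.point∈S j)) (≈-sym (proj₂ (F.point∈S j)))) ⟩
            0#                          ∎)
            where
            -α₀≈α₁ : - α₀ ≈ α₁
            -α₀≈α₁ = begin
              - α₀             ≈⟨ +-identityʳ _ ⟨
              - α₀ + 0#        ≈⟨ +-congˡ α₀+α₁≈0 ⟨
              - α₀ + (α₀ + α₁) ≈⟨ +-assoc _ _ _ ⟨
              - α₀ + α₀ + α₁   ≈⟨ +-congʳ (-‿inverseˡ α₀) ⟩
              0# + α₁          ≈⟨ +-identityˡ _ ⟩
              α₁               ∎
            ψy-ψz#0 : ψ y - ψ z # 0#
            ψy-ψz#0 with ψ⁻¹ , left , _ ← #⇒invertible ψy#ψz =
              invertibleˡ⇒# (ψ⁻¹ , ≈-trans (*-congˡ (x-0≈x _)) left)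

          α₁≈0 : α₁ ≈ 0#
          α₁≈0 = ≈-trans (≈-sym (≈-trans (+-congʳ α₀≈0) (+-identityˡ _))) α₀+α₁≈0

          drop₂ : ∀ {x y s} → x ≈ 0# → y ≈ 0# → x + (y + s) ≈ 0# → s ≈ 0#
          drop₂ x≈0 y≈0 x+y+s≈0 = ≈-trans (≈-sym (≈-trans (+-congʳ x≈0) (≈-trans (+-identityˡ _)
            (≈-trans (+-congʳ y≈0) (+-identityˡ _))))) x+y+s≈0

          Σα′≈0 = drop₂ α₀≈0 α₁≈0 Σα≈0
          Σα′q≈0 = λ i → drop₂ (≈-trans (*-congʳ α₀≈0) (zeroˡ _)) (≈-trans (*-congʳ α₁≈0) (zeroˡ _)) (Σαq≈0 i)

      -- With the all-ones point, the family attains the largest possible number `m + 1` of affinely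
      -- independent points; without it, the largest possible number `m` in the hyperplane where
      -- coordinate `e` is zero.
      facet : ∀ {m} (to : Fin m → I) (from : I → Fin m) → (∀ i → to (from i) ≡ i) →
              (rank : Fin m → ℕ) (q : Fin m → Point) →
              (∀ j → q j (to j) ≈ 0#) →
              (∀ i j → j ≢ i → q j (to i) ≈ 1# ⊎ rank i ℕ.< rank j) →
              (∀ j → q j e ≈ 0#) → (∀ j → X (q j)) →
              ∀ {ones} → (∀ i → ones i ≈ 1#) → X ones →
              DefinesFacet (Conv X) (const 0#) (λ x → x e)
      facet {m} to from to∘from rank q diagonal offDiagonal qe≈0 q∈X {ones} ones≈1 1∈X = record
        { valid = conv-nonneg
        ; d     = + m
        ; dim   = record
          { size        = ℕ.suc m
          ; dimension   = refl
          ; point       = ones ∷ᵛ q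
          ; point∈S     = λ { zero → ⊆-conv 1∈X ; (suc j) → ⊆-conv (q∈X j) }
          ; independent = independent
          ; maximal     = λ p _ → affinelyIndependent⇒≤ to from to∘from p
          }
        ; dimF  = record
          { size        = m
          ; dimension   = refl
          ; point       = q
          ; point∈S     = λ j → ⊆-conv (q∈X j) , ≈-sym (qe≈0 j)
          ; independent = affinelyIndependent-tail independent
          ; maximal     = λ p p∈S → affinelyIndependent-face⇒≤ to from to∘from e p (≈-sym ∘ proj₂ ∘ p∈S)
          }
        }
        where
        independent : AffinelyIndependent (ones ∷ᵛ q)
        independent =
          unitriangular⇒affinelyIndependent to from to∘from rank ones≈1 q diagonal offDiagonal

-- Lifted multicuts

lookup-injective : ∀ {a} {A : Set a} {xs : List A} → Unique xs →
                   ∀ {i j} → lookup xs i ≡ lookup xs j → i ≡ j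
lookup-injective (_ ∷ _)  {zero}  {zero}  _  = refl
lookup-injective (x≢ ∷ _) {zero}  {suc j} eq =
  contradiction (subst (_∈ _) (sym eq) (∈-lookup j)) (All¬⇒¬Any x≢)
lookup-injective (x≢ ∷ _) {suc i} {zero}  eq =
  contradiction (subst (_∈ _) eq (∈-lookup i)) (All¬⇒¬Any x≢)
lookup-injective (_ ∷ xs!) {suc i} {suc j} eq = cong suc (lookup-injective xs! eq)

module _ {G : Graph n} (D : Decomposition G) where

  open Decomposition D

  Inside : Edge G → Set
  Inside e = lo e ~ hi e

  ends-inside : ∀ {e} → Ends e v w → Inside e → v ~ w
  ends-inside (inj₁ (refl , refl)) = id
  ends-inside (inj₂ (refl , refl)) = ~.sym

  inside-walk : (p : Walk G v w) → All Inside (walkEdges G p) → v ~ w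
  inside-walk ε       _                = ~.refl
  inside-walk (a ◅ p) (inside ∷ rest) =
    ~.trans (ends-inside {e = edge G a} (ends-edge G a) inside) (inside-walk p rest)

  -- The assumption `w ~ v` joins the ends of the walk the other way round: for a cycle it starts as
  -- the closing edge, and it absorbs each edge passed before `e`.
  inside-walk-─ : ∀ {e} (p : Walk G v w) (e∈ : e ∈ walkEdges G p) →
                  All Inside (walkEdges G p ─ e∈) → w ~ v → Inside e
  inside-walk-─ (a ◅ p) (here refl) rest w~v =
    close (ends-edge G a) (~.trans (inside-walk p rest) w~v)
    where
    close : ∀ {v w} → Ends (edge G a) v w → w ~ v → Inside (edge G a)
    close (inj₁ (refl , refl)) = ~.sym
    close (inj₂ (refl , refl)) = id
  inside-walk-─ (a ◅ p) (there e∈) (inside ∷ rest) w~v =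
    inside-walk-─ p e∈ rest (~.trans w~v (ends-inside {e = edge G a} (ends-edge G a) inside))

  inside-cycle-─ : (C : Cycle G) {e : Edge G} (e∈ : e ∈ Cycle.edges C) →
                   All Inside (Cycle.edges C ─ e∈) → Inside e
  inside-cycle-─ C (here refl) rest = close (ends-edge G closing) (inside-walk (proj₁ path) rest)
    where
    open Cycle C
    close : ∀ {v w} → Ends (edge G closing) v w → w ~ v → Inside (edge G closing)
    close (inj₁ (refl , refl)) = ~.sym
    close (inj₂ (refl , refl)) = id
  inside-cycle-─ C (there e∈) (inside ∷ rest) = inside-walk-─ (proj₁ path) e∈ rest
    (ends-inside {e = edge G closing} (ends-edge G closing) inside)
    where open Cycle C

-- Existence of minimal cuts

module _ (G : Graph n) where

  -- Edges are removed as long as the rest still separates. Whether it does is not decided, hence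
  -- the double negation.
  ¬¬minimalCut : ∀ {D} → Unique D → ¬ ConnectedWithout G D v w →
                 ¬ ¬ (Σ[ C ∈ List (Edge G) ] C ⊆ D × IsCut G v w C)
  ¬¬minimalCut {v = v} {w} D! sep = go D! sep (<-wellFounded _)
    where
    go : ∀ {D} → Unique D → ¬ ConnectedWithout G D v w → Acc ℕ._<_ (length D) →
         ¬ ¬ (Σ[ C ∈ List (Edge G) ] C ⊆ D × IsCut G v w C)
    go {D} D! sep (acc rec) none = none (D , id , record
      { unique    = D!
      ; separates = sep
      ; minimal   = λ {D′} D′⊆D sep′ {e} e∈D → minimal D′ D′⊆D sep′ e∈D (e ∈? D′)
      })
      where
      open import Data.List.Membership.DecPropositional (_≟ᴱ_ G) using (_∈?_)
      minimal : ∀ {e} D′ → D′ ⊆ D → ¬ ConnectedWithout G D′ v w → e ∈ D → Dec (e ∈ D′) → e ∈ D′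
      minimal     D′ D′⊆D sep′ e∈D (yes e∈D′) = e∈D′
      -- A separating `D′` that misses `e` lies in `D` without `e`, which therefore separates too
      -- and is shorter.
      minimal {e} D′ D′⊆D sep′ e∈D (no  e∉D′) = ⊥-elim
        (go (filter⁺ ≢e? D!)
            (sep′ ∘ Star.map λ { (a , a∉) → a , λ a∈ → a∉ (∈-filter⁺ ≢e? (D′⊆D a∈) λ { refl → e∉D′ a∈ }) })
            (rec (filter-notAll ≢e? D (Any.map (λ { refl ≢e → ≢e refl }) e∈D)))
            λ (C , C⊆ , cut) → none (C , proj₁ ∘ ∈-filter⁻ ≢e? ∘ C⊆ , cut))
        where ≢e? = λ f → ¬? (_≟ᴱ_ G f e)

-- Points of `X` and decompositions

module MulticutProperties {c ℓ₁ ℓ₂ ℓ₃} (K : OrderedField c ℓ₁ ℓ₂ ℓ₃)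
                          {n} (G G′ : Graph n) (G⊆G′ : G ⊆ᴳ G′) where

  open OrderedField K hiding (zero) renaming (refl to ≈-refl; sym to ≈-sym; trans to ≈-trans)
  open OrderedFieldProperties K
  open LiftedMulticut K G G′ G⊆G′
  open PolytopeProperties K (Edge G′)

  incl : Edge G → Edge G′
  incl = inclᴱ {G = G} {H = G′} G⊆G′

  module _ (D : Decomposition G) where

    open Decomposition D

    multicut : Point
    multicut e with lo e ~? hi e
    ... | yes _ = 0#
    ... | no  _ = 1#

    multicut-binary : ∀ e → Binary (multicut e)
    multicut-binary e with lo e ~? hi e
    ... | yes _ = inj₁ ≈-refl
    ... | no  _ = inj₂ ≈-refl

    ~⇒0 : ∀ {e v w} → Ends e v w → v ~ w → multicut e ≈ 0#
    ~⇒0 {e} _    v~w with lo e ~? hi e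
    ~⇒0     _                        v~w | yes _    = ≈-refl
    ~⇒0 (inj₁ (refl , refl)) v~w | no lo≁hi = contradiction v~w lo≁hi
    ~⇒0 (inj₂ (refl , refl)) v~w | no lo≁hi = contradiction (~.sym v~w) lo≁hi

    ≁⇒1 : ∀ {e v w} → Ends e v w → ¬ v ~ w → multicut e ≈ 1#
    ≁⇒1 {e} _    v≁w with lo e ~? hi e
    ≁⇒1     _                        v≁w | no _      = ≈-refl
    ≁⇒1 (inj₁ (refl , refl)) v≁w | yes lo~hi = contradiction lo~hi v≁w
    ≁⇒1 (inj₂ (refl , refl)) v≁w | yes lo~hi = contradiction (~.sym lo~hi) v≁w

    0⇒~ : ∀ {e v w} → Ends e v w → multicut e ≈ 0# → v ~ w
    0⇒~ {e} _    x≈0 with lo e ~? hi e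
    0⇒~ (inj₁ (refl , refl)) x≈0 | yes lo~hi = lo~hi
    0⇒~ (inj₂ (refl , refl)) x≈0 | yes lo~hi = ~.sym lo~hi
    0⇒~ _                        x≈0 | no _      = contradiction x≈0 1≉0

    private
      0⇒inside : ∀ {es} → All (λ e → multicut (incl e) ≈ 0#) es → All (Inside D) es
      0⇒inside = All.map λ {e} → 0⇒~ {incl e} (ends-inclᴱ G G′ G⊆G′ {e} (inj₁ (refl , refl)))

    -- A violated inequality has only zero terms on the right. For a cycle or path, its zero edges
    -- would join the ends of an edge of value one; for a cut, all its edges have value one, so the
    -- zero edges joining `v` and `w` avoid it.
    multicut∈X : X multicut
    multicut∈X = record
      { binary = multicut-binary
      ; cycles = λ C {e} e∈C → binary≤listSum (multicut ∘ incl) (multicut-binary ∘ incl)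
          (multicut-binary (incl e)) λ x≈1 rest≈0 →
          1≉0 (≈-trans (≈-sym x≈1) (~⇒0 {incl e} (ends-inclᴱ G G′ G⊆G′ {e} (inj₁ (refl , refl)))
                                     (inside-cycle-─ D C e∈C (0⇒inside rest≈0))))
      ; paths  = λ vw _ P → binary≤listSum (multicut ∘ incl) (multicut-binary ∘ incl)
          (multicut-binary (edge G′ vw)) λ x≈1 all≈0 →
          1≉0 (≈-trans (≈-sym x≈1) (~⇒0 {edge G′ vw} (ends-edge G′ vw)
                                     (inside-walk D (proj₁ P) (0⇒inside all≈0))))
      ; cuts   = λ vw _ {C} cut → binary≤listSum (λ e → 1# - multicut (incl e))
          (binary-1- ∘ multicut-binary ∘ incl)
          (binary-1- (multicut-binary (edge G′ vw))) λ 1-x≈1 all≈0 →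
          IsCut.separates cut (Star.map (λ {i} {j} (a , i~j) → a , λ a∈C →
            1≉0 (≈-trans (≈-sym (x-0≈x 1#)) (≈-trans (+-congˡ (-‿cong (≈-sym
              (~⇒0 {incl (edge G a)} (ends-inclᴱ G G′ G⊆G′ {edge G a} (ends-edge G a)) i~j))))
              (All.lookup all≈0 a∈C))))
            (connected (0⇒~ {edge G′ vw} (ends-edge G′ vw) (x≈0 (multicut-binary (edge G′ vw)) 1-x≈1))))
      }
      where
      x≈0 : ∀ {x} → Binary x → 1# - x ≈ 1# → x ≈ 0#
      x≈0 (inj₁ x≈0) _     = x≈0
      x≈0 (inj₂ x≈1) 1-x≈1 = ⊥-elim (1≉0 (≈-trans (≈-sym 1-x≈1)
        (≈-trans (+-congˡ (-‿cong x≈1)) (x-x≈0 1#))))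

  -- The closure `Star (Zero x)` recovers the classes of the decomposition behind a point `x` of
  -- `X`.
  Zero : Point → Rel (Fin n) ℓ₁
  Zero x v w = Σ[ a ∈ Adj G v w ] x (incl (edge G a)) ≈ 0#

  ~⇒zeroConnected : ∀ D {v w} → Decomposition._~_ D v w → Star (Zero (multicut D)) v w
  ~⇒zeroConnected D v~w = Star.map (λ (a , i~j) → a ,
    ~⇒0 D {incl (edge G a)} (ends-inclᴱ G G′ G⊆G′ {edge G a} (ends-edge G a)) i~j)
    (Decomposition.connected D v~w)

  module _ {x : Point} (x∈X : X x) where

    open X x∈X

    zero-sym : ∀ {v w} → Zero x v w → Zero x w v
    zero-sym (a , x≈0) = Graph.adj-sym G a ,
      ≈-trans (reflexive (cong (x ∘ incl) (edge-swap G _ a))) x≈0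

    zeroPath : ∀ {v w} → Star (Zero x) v w →
               Σ[ P ∈ Path G v w ] (All (λ e → x (incl e) ≈ 0#) (pathEdges G P) ×
                                    (∀ {t} → t ∈ pathNodes G P → Star (Zero x) v t))
    zeroPath v~w = let P , along = loopErase {G = G} proj₁ v~w; p = proj₁ P in P ,
      along-all (λ a (b , x≈0) → ≈-trans (reflexive (cong (x ∘ incl) (edge-cong G a b))) x≈0) p along ,
      along-star p along

    -- If `vw` is no edge of `G`, the path inequality of a zero path applies. Otherwise the cycle
    -- inequality does, since the path closes up with `vw` to a cycle unless it is `vw` itself.
    zeroConnected⇒0 : ∀ {v w} → Star (Zero x) v w → (vw : Adj G′ v w) → x (edge G′ vw) ≈ 0#
    zeroConnected⇒0 {v} {w} v~w vw =
      [ id , (λ x≈1 → ⊥-elim (impossible x≈1 (Graph.adj? G v w))) ]′ (binary (edge G′ vw))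
      where
      P = proj₁ (zeroPath v~w)
      P≈0 = proj₁ (proj₂ (zeroPath v~w))
      impossible : x (edge G′ vw) ≈ 1# → Dec (Adj G v w) → ⊥
      impossible x≈1 (no ¬vw) = 1≰listSum (x ∘ incl) x≈1 P≈0 (paths vw ¬vw P)
      impossible x≈1 (yes a)  = byLength P P≈0
        where
        x≈1′ : ∀ {v′ w′} (b : Adj G v′ w′) → Ends (edge G b) v w → x (incl (edge G b)) ≈ 1#
        x≈1′ b ends = ≈-trans (reflexive (cong x (ends-injective
          (ends-inclᴱ G G′ G⊆G′ {edge G b} ends) (ends-edge G′ vw)))) x≈1
        byLength : (P : Path G v w) → All (λ e → x (incl e) ≈ 0#) (pathEdges G P) → ⊥
        byLength (ε , _)           _             = Graph.adj-irrefl G a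
        byLength (b ◅ ε , _)       (x≈0 ∷ _)     =
          1≉0 (≈-trans (≈-sym (x≈1′ b (ends-edge G b))) x≈0)
        byLength P@(_ ◅ _ ◅ _ , _) all           =
          1≰listSum (x ∘ incl) (x≈1′ a′ (swap (ends-edge G a′))) all
            (cycles (record { path = P ; closing = a′ ; long = s≤s (s≤s z≤n) }) (here refl))
          where a′ = Graph.adj-sym G a

    -- Without a zero connection, the edges of value one separate `v` from `w` and so contain a
    -- minimal cut, whose inequality would read `1# ≤ᴷ 0#`. An edge of `G` is itself a zero step.
    0⇒¬¬zeroConnected : ∀ {v w} (vw : Adj G′ v w) → x (edge G′ vw) ≈ 0# → ¬ ¬ Star (Zero x) v w
    0⇒¬¬zeroConnected {v} {w} vw x≈0 v≁w = impossible (Graph.adj? G v w)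
      where
      one? : ∀ e → Dec (x (incl e) ≈ 1#)
      one? e = [ (λ x≈0 → no λ x≈1 → 1≉0 (≈-trans (≈-sym x≈1) x≈0)) , yes ]′ (binary (incl e))
      ones = filter one? (allEdges G)
      separates : ¬ ConnectedWithout G ones v w
      separates v~w = v≁w (Star.map (λ (a , a∉) → a ,
        [ id , (λ x≈1 → contradiction (∈-filter⁺ one? (∈-allEdges G _) x≈1) a∉) ]′
          (binary (incl (edge G a)))) v~w)
      impossible : Dec (Adj G v w) → ⊥
      impossible (yes a) = v≁w ((a , ≈-trans (reflexive (cong x
        (trans (inclᴱ-edge G G′ G⊆G′ a) (edge-cong G′ (G⊆G′ a) vw)))) x≈0) ◅ ε)
      impossible (no ¬a) = ¬¬minimalCut G (filter⁺ one? (allEdges-unique G)) separates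
        λ (C , C⊆ones , cut) → 1≰listSum (λ e → 1# - x (incl e))
          (≈-trans (+-congˡ (-‿cong x≈0)) (x-0≈x 1#))
          (All.tabulate λ e∈C → ≈-trans (+-congˡ (-‿cong (proj₂ (∈-filter⁻ one? {xs = allEdges G} (C⊆ones e∈C)))))
                                      (x-x≈0 1#))
          (cuts vw ¬a cut)

    -- A zero connection to `r` carries over between `s` and `t`; stability of `≈` absorbs the
    -- double negation.
    zeroConnected⇒≈ : ∀ {r s t} → Star (Zero x) s t → (sr : Adj G′ s r) (tr : Adj G′ t r) →
                      x (edge G′ sr) ≈ x (edge G′ tr)
    zeroConnected⇒≈ {r} {s} {t} s~t sr tr = compare (binary (edge G′ sr)) (binary (edge G′ tr))
      where
      transport : ∀ {a b} → Star (Zero x) a b → (ar : Adj G′ a r) (br : Adj G′ b r) →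
                  x (edge G′ ar) ≈ 0# → x (edge G′ br) ≈ 0#
      transport a~b ar br x≈0 = ≈-stable λ x≉0 → 0⇒¬¬zeroConnected ar x≈0 λ a~r →
        x≉0 (zeroConnected⇒0 (Star.reverse zero-sym a~b ◅◅ a~r) br)
      compare : Binary (x (edge G′ sr)) → Binary (x (edge G′ tr)) → x (edge G′ sr) ≈ x (edge G′ tr)
      compare (inj₁ x≈0) _          = ≈-trans x≈0 (≈-sym (transport s~t sr tr x≈0))
      compare (inj₂ x≈1) (inj₁ y≈0) = ≈-trans (transport (Star.reverse zero-sym s~t) tr sr y≈0) (≈-sym y≈0)
      compare (inj₂ x≈1) (inj₂ y≈1) = ≈-trans x≈1 (≈-sym y≈1)

  -- Necessary conditions

  module _ {u v : Fin n} (uv : Adj G′ u v) where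

    private
      e = edge G′ uv
      ones = multicut (discrete G)

      ones≈1 : ∀ {i j} (ij : Adj G′ i j) → ones (edge G′ ij) ≈ 1#
      ones≈1 ij = ≁⇒1 (discrete G) {edge G′ ij} (ends-edge G′ ij)
        λ { (inj₁ refl) → Graph.adj-irrefl G′ ij }

    -- Applies `¬facet` to the all-ones point and the multicut of `D`, which both lie off the face.
    -- Stability of `≈` lets the assumption on `ψ` take an actual zero connection of `u` and `v`.
    ¬facet-multicut : ∀ {ψ} → Linear ψ → (∀ {x} → X x → Star (Zero x) u v → ψ x ≈ 0#) →
                      (D : Decomposition G) → ¬ Decomposition._~_ D u v →
                      ψ ones # ψ (multicut D) → ¬ LowerBoundDefinesFacet e
    ¬facet-multicut {ψ} ψ-linear ψ≈0 D u≁v = ¬facet X.binary e ψ-linear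
      (λ x∈X xe≈0 → ≈-stable λ ψ≉0 → 0⇒¬¬zeroConnected x∈X uv xe≈0 (ψ≉0 ∘ ψ≈0 x∈X))
      (multicut∈X (discrete G)) (multicut∈X D) (ones≈1 uv) (≁⇒1 D {e} (ends-edge G′ uv) u≁v)

    -- On the face the values at `sr` and `tr` agree. They differ at a multicut that joins `r` to
    -- exactly one of `s` and `t`, so this multicut also lies off the face.
    ¬facet-neighbours : Connected G → ∀ {r s t} → Adj G′ s r → Adj G′ t r → s ≢ t →
                        (∀ {x} → X x → Star (Zero x) u v → Star (Zero x) s t) →
                        ¬ LowerBoundDefinesFacet e
    ¬facet-neighbours conn {r} sr tr s≢t u~v⇒s~t =
      [ (λ (r~s , r≁t) → merged sr tr u~v⇒s~t r~s r≁t)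
      , (λ (r≁s , r~t) → merged tr sr (λ x∈X → Star.reverse (zero-sym x∈X) ∘ u~v⇒s~t x∈X) r~t r≁s)
      ]′ (proj₂ separated)
      where
      separated = separateNeighbours G conn
        (λ { refl → Graph.adj-irrefl G′ sr }) (λ { refl → Graph.adj-irrefl G′ tr }) s≢t
      D = proj₁ separated
      open Decomposition D
      merged : ∀ {s t} (sr : Adj G′ s r) (tr : Adj G′ t r) →
               (∀ {x} → X x → Star (Zero x) u v → Star (Zero x) s t) →
               r ~ s → ¬ r ~ t → ¬ LowerBoundDefinesFacet e
      merged sr tr u~v⇒s~t r~s r≁t = ¬facet-multicut
        (minus-linear (coordinate-linear (edge G′ tr)) (coordinate-linear (edge G′ sr)))
        ψ≈0 D (λ u~v → 1≉0 (≈-trans (≈-sym ψD≈1) (ψ≈0 (multicut∈X D) (~⇒zeroConnected D u~v))))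
        (#-sym (#-congʳ (≈-sym ψD≈1) (#-congˡ (≈-sym ψones≈0) 1#0)))
        where
        ψ = λ x → x (edge G′ tr) - x (edge G′ sr)
        ψ≈0 : ∀ {x} → X x → Star (Zero x) u v → ψ x ≈ 0#
        ψ≈0 x∈X u~v = ≈-trans (+-congʳ (≈-sym (zeroConnected⇒≈ x∈X (u~v⇒s~t x∈X u~v) sr tr))) (x-x≈0 _)
        ψD≈1 : ψ (multicut D) ≈ 1#
        ψD≈1 = ≈-trans (+-cong (≁⇒1 D {edge G′ tr} (ends-edge G′ tr) (r≁t ∘ ~.sym))
                             (-‿cong (~⇒0 D {edge G′ sr} (ends-edge G′ sr) (~.sym r~s))))
                     (x-0≈x 1#)
        ψones≈0 : ψ ones ≈ 0#
        ψones≈0 = ≈-trans (+-cong (ones≈1 tr) (-‿cong (ones≈1 sr))) (x-x≈0 1#)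

    ¬facet-adjacent : ∀ {s t} → Adj G′ s t →
                      (∀ {x} → X x → Star (Zero x) u v → Star (Zero x) s t) →
                      (D : Decomposition G) → Decomposition._~_ D s t → ¬ Decomposition._~_ D u v →
                      ¬ LowerBoundDefinesFacet e
    ¬facet-adjacent st u~v⇒s~t D s~t u≁v = ¬facet-multicut
      (coordinate-linear (edge G′ st)) (λ x∈X u~v → zeroConnected⇒0 x∈X (u~v⇒s~t x∈X u~v) st) D u≁v
      (#-congʳ (≈-sym (ones≈1 st)) (#-congˡ (≈-sym (~⇒0 D {edge G′ st} (ends-edge G′ st) s~t)) 1#0))

    -- If `t` is joined to `s`, then `st` has value zero and `ss′`, `ts′` have equal values; if `t`
    -- is joined to `s′`, then `ts′` has value zero and `st`, `ss′` have equal values. Either way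
    -- `ψ` vanishes, while it is one at the all-ones point.
    ¬facet-triangle : ∀ {s s′ t} → Adj G′ s t → Adj G′ s s′ → Adj G′ t s′ →
                      (∀ {x} → X x → Star (Zero x) u v → Star (Zero x) s t ⊎ Star (Zero x) s′ t) →
                      (D : Decomposition G) → Decomposition._~_ D s t → ¬ Decomposition._~_ D u v →
                      ¬ LowerBoundDefinesFacet e
    ¬facet-triangle {s} {s′} {t} st ss′ ts′ u~v⇒ D s~t u≁v = ¬facet-multicut
      (minus-linear (coordinate-linear (edge G′ st))
        (minus-linear (coordinate-linear (edge G′ ss′)) (coordinate-linear (edge G′ ts′))))
      (λ x∈X u~v → ψ≈0 x∈X (u~v⇒ x∈X u~v)) D u≁v
      (#-congʳ (≈-sym ψones≈1) (#-congˡ (≈-sym (ψ≈0 (multicut∈X D) (inj₁ (~⇒zeroConnected D s~t)))) 1#0))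
      where
      ψ = λ x → x (edge G′ st) - (x (edge G′ ss′) - x (edge G′ ts′))
      ψ≈0 : ∀ {x} → X x → Star (Zero x) s t ⊎ Star (Zero x) s′ t → ψ x ≈ 0#
      ψ≈0 x∈X (inj₁ s~t)  = ≈-trans (+-cong (zeroConnected⇒0 x∈X s~t st)
        (-‿cong (≈-trans (+-congʳ (zeroConnected⇒≈ x∈X s~t ss′ ts′)) (x-x≈0 _)))) (x-x≈0 0#)
      ψ≈0 {x} x∈X (inj₂ s′~t) = ≈-trans (+-cong
        (reflexive (cong x (edge-swap G′ st ts)))
        (-‿cong (≈-trans (+-cong (reflexive (cong x (edge-swap G′ ss′ s′s)))
          (-‿cong (zeroConnected⇒0 x∈X (Star.reverse (zero-sym x∈X) s′~t) ts′))) (x-0≈x _))))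
        (≈-trans (+-congʳ (≈-sym (zeroConnected⇒≈ x∈X s′~t s′s ts))) (x-x≈0 _))
        where
        ts  = Graph.adj-sym G′ st
        s′s = Graph.adj-sym G′ ss′
      ψones≈1 : ψ ones ≈ 1#
      ψones≈1 = ≈-trans (+-cong (ones≈1 st)
        (-‿cong (≈-trans (+-cong (ones≈1 ss′) (-‿cong (ones≈1 ts′))) (x-x≈0 1#)))) (x-0≈x 1#)

    -- A zero path from `u` to `v` passes through both cut-vertices.
    cutVertices-zeroConnected : ∀ {s t} → IsCutVertex G u v s → IsCutVertex G u v t →
      ∀ {x} → X x → Star (Zero x) u v → Star (Zero x) s t
    cutVertices-zeroConnected s-cut t-cut x∈X u~v =
      let P , _ , connected = zeroPath x∈X u~v
      in Star.reverse (zero-sym x∈X) (connected (s-cut P)) ◅◅ connected (t-cut P)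

    ¬~-contract : ∀ {p q} (Q : Path G p q) → ¬ (u ∈ pathNodes G Q × v ∈ pathNodes G Q) →
                  ¬ Decomposition._~_ (contract (proj₁ Q)) u v
    ¬~-contract Q _     (inj₁ refl) = Graph.adj-irrefl G′ uv
    ¬~-contract Q ¬both (inj₂ both)   = ¬both both

    SamePair : Rel (Fin n) 0ℓ
    SamePair s t = (s ≡ u × t ≡ v) ⊎ (s ≡ v × t ≡ u)

    samePair : ∀ {s t} → s ≢ t → s ≡ u ⊎ s ≡ v → t ≡ u ⊎ t ≡ v → SamePair s t
    samePair s≢t (inj₁ s≡u) (inj₁ t≡u) = contradiction (trans s≡u (sym t≡u)) s≢t
    samePair s≢t (inj₁ s≡u) (inj₂ t≡v) = inj₁ (s≡u , t≡v)
    samePair s≢t (inj₂ s≡v) (inj₁ t≡u) = inj₂ (s≡v , t≡u)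
    samePair s≢t (inj₂ s≡v) (inj₂ t≡v) = contradiction (trans s≡v (sym t≡v)) s≢t

    facet⇒distance≥3 : Connected G → LowerBoundDefinesFacet e →
      ∀ {s t} → IsCutVertex G u v s → IsCutVertex G u v t → s ≢ t → ¬ SamePair s t →
      DistanceAtLeast G′ 3 s t
    facet⇒distance≥3 conn facet s-cut t-cut s≢t ¬pair (ε , _) = contradiction refl s≢t
    -- If `Q` contained `u` and `v`, its part between them would contain the cut-vertices `s` and
    -- `t`. These are the ends of `Q`, so they would be `u` and `v`.
    facet⇒distance≥3 conn facet {s} {t} s-cut t-cut s≢t ¬pair (st ◅ ε , _) = contradiction facet
      (¬facet-adjacent st (cutVertices-zeroConnected s-cut t-cut) (contract (proj₁ Q))
        (inj₂ (source∈ (proj₁ Q) , target∈ (proj₁ Q)))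
        (¬~-contract Q λ (u∈Q , v∈Q) →
          let R , _ , s∈⇒ , t∈⇒ = subpath Q u∈Q v∈Q
          in ¬pair (samePair s≢t (s∈⇒ (s-cut R)) (t∈⇒ (t-cut R)))))
      where Q = proj₁ (loopErase {G = G} id (conn s t))
    -- The middle node `r` is adjacent to both cut-vertices, which lie in one class on the face.
    facet⇒distance≥3 conn facet s-cut t-cut s≢t ¬pair (sr ◅ rt ◅ ε , _) = contradiction facet
      (¬facet-neighbours conn sr (Graph.adj-sym G′ rt) s≢t (cutVertices-zeroConnected s-cut t-cut))
    facet⇒distance≥3 conn facet s-cut t-cut s≢t ¬pair (_ ◅ _ ◅ _ ◅ _ , _) = s≤s (s≤s (s≤s z≤n))

    -- A path from `t` to `s` that misses `s′` is merged. If it meets `s′`, its prefix up to `s′`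
    -- misses `s`, and the symmetric roles of `s` and `s′` are exchanged.
    facet⇒noSeparatingTriangle : Connected G → LowerBoundDefinesFacet e →
      ∀ {s s′ t} → Adj G′ s t → Adj G′ s s′ → Adj G′ t s′ →
      ((P : Path G u v) → s ∈ pathNodes G P ⊎ s′ ∈ pathNodes G P) → ¬ IsCutVertex G u v t
    facet⇒noSeparatingTriangle conn facet {s} {s′} {t} st ss′ ts′ separating t-cut =
      toFirst (s′ ∈? pathNodes G P)
      where
      open import Data.List.Membership.DecPropositional (_≟_ {n}) using (_∈?_)
      P = proj₁ (loopErase {G = G} id (conn t s))

      avoiding : ∀ {s s′} → Adj G′ s t → Adj G′ s s′ → Adj G′ t s′ →
                 ((P : Path G u v) → s ∈ pathNodes G P ⊎ s′ ∈ pathNodes G P) →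
                 (Q : Path G t s) → s′ ∉ pathNodes G Q → ⊥
      avoiding {s} {s′} st ss′ ts′ separating Q s′∉Q = ¬facet-triangle st ss′ ts′
        (λ x∈X u~v →
          let P , _ , connected = zeroPath x∈X u~v
              to-t = λ {s} (s∈P : s ∈ pathNodes G P) →
                Star.reverse (zero-sym x∈X) (connected s∈P) ◅◅ connected (t-cut P)
          in Sum.map to-t to-t (separating P))
        (contract (proj₁ Q)) (inj₂ (target∈ (proj₁ Q) , source∈ (proj₁ Q)))
        -- If `Q` contained `u` and `v`, its part between them would avoid `s′` and thus contain
        -- `s`, and also `t`. Then `s` and `t` would be `u` and `v`, with `s′` as common neighbour,
        -- which is excluded already.
        (¬~-contract Q λ (u∈Q , v∈Q) →
          let R , R⊆Q , t∈⇒ , s∈⇒ = subpath Q u∈Q v∈Q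
              s∈R = [ id , (λ s′∈R → contradiction (R⊆Q s′∈R) s′∉Q) ]′ (separating R)
              s≢t = λ { refl → Graph.adj-irrefl G′ st }
          in ¬facet-neighbours conn ss′ ts′ s≢t (joins (samePair s≢t (s∈⇒ s∈R) (t∈⇒ (t-cut R)))) facet)
        facet
        where
        joins : SamePair s t → ∀ {x} → X x → Star (Zero x) u v → Star (Zero x) s t
        joins (inj₁ (refl , refl)) x∈X = id
        joins (inj₂ (refl , refl)) x∈X = Star.reverse (zero-sym x∈X)

      toFirst : Dec (s′ ∈ pathNodes G P) → ⊥
      toFirst (no  s′∉P) = avoiding st ss′ ts′ separating P s′∉P
      toFirst (yes s′∈P) =
        let R , _ , s∈⇒ = prefix P s′∈P
        in avoiding (Graph.adj-sym G′ ts′) (Graph.adj-sym G′ ss′) (Graph.adj-sym G′ st)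
             (swap ∘ separating) R (λ s∈R → s≢s′ (s∈⇒ s∈R))
        where
        s≢s′ : s ≢ s′
        s≢s′ refl = Graph.adj-irrefl G′ ss′

-- Triangles

module _ (G : Graph n) where

  open Graph G using (adj-sym; adj-irrefl)

  triangle-adj : (T : Triangle G) → ∀ {x y} → x ∈ Cycle.nodes (proj₁ T) →
                 y ∈ Cycle.nodes (proj₁ T) → x ≢ y → Adj G x y
  triangle-adj (record { path = ε , _ ; long = () } , _)
  triangle-adj (record { path = _ ◅ ε , _ ; long = s≤s () } , _)
  triangle-adj (record { path = _ ◅ _ ◅ _ ◅ _ , _ } , ())
  triangle-adj (record { path = a ◅ b ◅ ε , _ ; closing = c } , refl) = λ
    { (here refl)                 (here refl)                 x≢y → contradiction refl x≢y
    ; (here refl)                 (there (here refl))         _   → a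
    ; (here refl)                 (there (there (here refl))) _   → adj-sym c
    ; (there (here refl))         (here refl)                 _   → adj-sym a
    ; (there (here refl))         (there (here refl))         x≢y → contradiction refl x≢y
    ; (there (here refl))         (there (there (here refl))) _   → b
    ; (there (there (here refl))) (here refl)                 _   → c
    ; (there (there (here refl))) (there (here refl))         _   → adj-sym b
    ; (there (there (here refl))) (there (there (here refl))) x≢y → contradiction refl x≢y
    }

  triangleOn⇒adj : ∀ {a b c} → TriangleOn G a b c → Adj G a b × Adj G a c × Adj G c b
  triangleOn⇒adj {a} {b} {c} (T , nodes↭) = adj a∈ b∈ a≢b , adj a∈ c∈ a≢c , adj c∈ b∈ (b≢c ∘ sym)
    where
    adj = triangle-adj T
    a∈ = ∈-resp-↭ (↭-sym nodes↭) (here refl)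
    b∈ = ∈-resp-↭ (↭-sym nodes↭) (there (here refl))
    c∈ = ∈-resp-↭ (↭-sym nodes↭) (there (there (here refl)))
    abc! : Unique (a ∷ b ∷ c ∷ [])
    abc! = Permutation.Unique-resp-↭ (≡.setoid (Fin n)) (↭⇒↭ₛ nodes↭) (proj₂ (Cycle.path (proj₁ T)))
    a≢b : a ≢ b
    a≢b with (p ∷ _) ∷ _ ← abc! = p
    a≢c : a ≢ c
    a≢c with (_ ∷ p ∷ _) ∷ _ ← abc! = p
    b≢c : b ≢ c
    b≢c with _ ∷ (p ∷ _) ∷ _ ← abc! = p

  inTriangle⇒neighbour : (uv : Adj G u v) → InTriangle G (edge G uv) → ∃[ r ] Adj G u r × Adj G v r
  inTriangle⇒neighbour uv ((record { path = ε , _ ; long = () } , _) , _)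
  inTriangle⇒neighbour uv ((record { path = _ ◅ ε , _ ; long = s≤s () } , _) , _)
  inTriangle⇒neighbour uv ((record { path = _ ◅ _ ◅ _ ◅ _ , _ } , ()) , _)
  inTriangle⇒neighbour {u = u} {v} uv
    ((record { path = a ◅ b ◅ ε , _ ; closing = c } , refl) , e∈) = go e∈
    where
    third : ∀ {i j k} (ij : Adj G i j) → edge G uv ≡ edge G ij → Adj G i k → Adj G j k →
            ∃[ r ] Adj G u r × Adj G v r
    third ij eq ik jk with ends-unique {e = edge G uv} (ends-edge G uv)
                             (subst (λ e → Ends e _ _) (sym eq) (ends-edge G ij))
    ... | inj₁ (refl , refl) = _ , ik , jk
    ... | inj₂ (refl , refl) = _ , jk , ik
    go : edge G uv ∈ edge G c ∷ edge G a ∷ edge G b ∷ [] → ∃[ r ] Adj G u r × Adj G v r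
    go (here eq)                 = third c eq (adj-sym b) a
    go (there (here eq))         = third a eq (adj-sym c) b
    go (there (there (here eq))) = third b eq (adj-sym a) c

  neighbour⇒inTriangle : ∀ {r} (uv : Adj G u v) → Adj G u r → Adj G v r → InTriangle G (edge G uv)
  neighbour⇒inTriangle {u = u} {v} {r} uv ur vr =
    (record { path = (vr ◅ adj-sym ur ◅ ε) , unique ; closing = uv ; long = s≤s (s≤s z≤n) } , refl) , here refl
    where
    unique : Unique (v ∷ r ∷ u ∷ [])
    unique = ((λ { refl → adj-irrefl vr }) ∷ (λ { refl → adj-irrefl uv }) ∷ []) ∷
             ((λ { refl → adj-irrefl ur }) ∷ []) ∷ [] ∷ []

-- Shortest walks in the contraction of an edge

least : {P : ℕ → Set} → (∀ k → Dec (P k)) → ∀ k → P k → ∃[ m ] P m × (∀ {j} → P j → m ℕ.≤ j)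
least P? k       Pk with P? 0
least P? k       Pk | yes P0 = 0 , P0 , λ _ → z≤n
least P? zero    P0 | no ¬P0 = contradiction P0 ¬P0
least P? (suc k) Pk | no ¬P0 with m , Pm , m≤ ← least (P? ∘ suc) k Pk =
  suc m , Pm , λ { {zero} P0 → contradiction P0 ¬P0 ; {suc j} Pj → s≤s (m≤ Pj) }

module Contraction (G : Graph n) {u v : Fin n} (uv : Adj G u v) where

  open Graph G using (adj?; adj-sym; adj-irrefl)

  -- The node map of `G/uv`, represented on the nodes of `G` with `v` as the image of both ends.
  π : Fin n → Fin n
  π i with i ≟ u
  ... | yes _ = v
  ... | no  _ = i

  π-fibre : ∀ {i j} → π i ≡ π j → i ≡ j ⊎ (i ≡ u × j ≡ v) ⊎ (i ≡ v × j ≡ u)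
  π-fibre {i} {j} eq with i ≟ u | j ≟ u
  ... | yes i≡u | yes j≡u = inj₁ (trans i≡u (sym j≡u))
  ... | yes i≡u | no  _   = inj₂ (inj₁ (i≡u , sym eq))
  ... | no  _   | yes j≡u = inj₂ (inj₂ (eq , j≡u))
  ... | no  _   | no  _   = inj₁ eq

  πu≡πv : π u ≡ π v
  πu≡πv with u ≟ u | v ≟ u
  ... | no u≢u | _     = contradiction refl u≢u
  ... | yes _  | yes _ = refl
  ... | yes _  | no  _ = refl

  -- The edge `uv` leaves a loop at `v`, which no shortest walk uses.
  Adj/ : Rel (Fin n) 0ℓ
  Adj/ x y = ∃[ i ] ∃[ j ] Adj G i j × π i ≡ x × π j ≡ y

  -- The length is an index, so that existence is decidable for each length and the length can be
  -- minimised.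
  data Walk/ : ℕ → Rel (Fin n) 0ℓ where
    []  : ∀ {x} → Walk/ 0 x x
    _∷_ : ∀ {k x y z} → Adj/ x y → Walk/ k y z → Walk/ (suc k) x z

  walk/? : ∀ k x y → Dec (Walk/ k x y)
  walk/? zero    x y with x ≟ y
  ... | yes refl = yes []
  ... | no  x≢y  = no λ { [] → x≢y refl }
  walk/? (suc k) x y with any? (λ z → adj/? x z ×-dec walk/? k z y)
    where
    adj/? : ∀ x y → Dec (Adj/ x y)
    adj/? x y = any? λ i → any? λ j → adj? i j ×-dec ((π i ≟ x) ×-dec (π j ≟ y))
  ... | yes (_ , a , w) = yes (a ∷ w)
  ... | no  none        = no λ { (a ∷ w) → none (_ , a , w) }

  walk⇒walk/ : ∀ {i j} → Walk G i j → ∃[ k ] Walk/ k (π i) (π j)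
  walk⇒walk/ ε       = 0 , []
  walk⇒walk/ (a ◅ p) = let k , w = walk⇒walk/ p in suc k , (_ , _ , a , refl , refl) ∷ w

  walk/-sym : ∀ {k x y} → Walk/ k x y → Walk/ k y x
  walk/-sym []                          = []
  walk/-sym ((i , j , a , πi , πj) ∷ w) = snoc (walk/-sym w) (j , i , adj-sym a , πj , πi)
    where
    snoc : ∀ {k x y z} → Walk/ k x y → Adj/ y z → Walk/ (suc k) x z
    snoc []      b = b ∷ []
    snoc (a ∷ w) b = a ∷ snoc w b

  nodes/ : ∀ {k x y} → Walk/ k x y → List (Fin n)
  nodes/ {x = x} []      = x ∷ []
  nodes/ {x = x} (_ ∷ w) = x ∷ nodes/ w

  source∈/ : ∀ {k x y} (w : Walk/ k x y) → x ∈ nodes/ w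
  source∈/ []      = here refl
  source∈/ (_ ∷ _) = here refl

  target∈/ : ∀ {k x y} (w : Walk/ k x y) → y ∈ nodes/ w
  target∈/ []      = here refl
  target∈/ (_ ∷ w) = there (target∈/ w)

  Shorter : ℕ → Rel (Fin n) 0ℓ
  Shorter k x y = ∃[ j ] j ℕ.< k × Walk/ j x y

  shorter-sym : ∀ {k x y} → Shorter k x y → Shorter k y x
  shorter-sym (j , j<k , w) = j , j<k , walk/-sym w

  fromSource : ∀ {k x y z} (w : Walk/ k x y) → z ∈ nodes/ w → Shorter k x z ⊎ z ≡ y
  fromSource []      (here refl) = inj₂ refl
  fromSource (_ ∷ _) (here refl) = inj₁ (0 , s≤s z≤n , [])
  fromSource (a ∷ w) (there z∈) with fromSource w z∈
  ... | inj₁ (j , j<k , w′) = inj₁ (suc j , s≤s j<k , a ∷ w′)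
  ... | inj₂ z≡y            = inj₂ z≡y

  -- Only the pair of its ends is as far apart as a walk is long.
  onWalk : ∀ {k x y a b} (w : Walk/ k x y) → a ∈ nodes/ w → b ∈ nodes/ w →
           Shorter k a b ⊎ (a ≡ x × b ≡ y) ⊎ (a ≡ y × b ≡ x)
  onWalk []      (here refl) (here refl) = inj₂ (inj₁ (refl , refl))
  onWalk (_ ∷ _) (here refl) (here refl) = inj₁ (0 , s≤s z≤n , [])
  onWalk w@(_ ∷ _) (here refl) b∈@(there _) with fromSource w b∈
  ... | inj₁ shorter = inj₁ shorter
  ... | inj₂ b≡y     = inj₂ (inj₁ (refl , b≡y))
  onWalk w@(_ ∷ _) a∈@(there _) (here refl) with fromSource w a∈
  ... | inj₁ shorter = inj₁ (shorter-sym shorter)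
  ... | inj₂ a≡y     = inj₂ (inj₂ (a≡y , refl))
  onWalk (_ ∷ w) (there a∈) (there b∈) with onWalk w a∈ b∈
  ... | inj₁ (j , j<k , w′)       = inj₁ (j , ℕ.m<n⇒m<1+n j<k , w′)
  ... | inj₂ (inj₁ (refl , refl)) = inj₁ (_ , ℕ.n<1+n _ , w)
  ... | inj₂ (inj₂ (refl , refl)) = inj₁ (_ , ℕ.n<1+n _ , walk/-sym w)

  module _ (S : List (Fin n)) where

    private
      Step : Rel (Fin n) 0ℓ
      Step a b = Adj G a b × Merged G π S a b

    step-sym : ∀ {i j} → Step i j → Step j i
    step-sym (a , inj₁ eq)        = adj-sym a , inj₁ (sym eq)
    step-sym (a , inj₂ (i∈ , j∈)) = adj-sym a , inj₂ (j∈ , i∈)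

    fibre-connected : ∀ {i j} → π i ≡ π j → Star Step i j
    fibre-connected {i} {j} eq with π-fibre {i} {j} eq
    ... | inj₁ refl                 = ε
    ... | inj₂ (inj₁ (refl , refl)) = (uv , inj₁ eq) ◅ ε
    ... | inj₂ (inj₂ (refl , refl)) = (adj-sym uv , inj₁ eq) ◅ ε

    -- Each step lifts to an edge of `G`. Consecutive lifted edges need not meet in `G`, but their
    -- ends lie in one fibre, which is crossed along `uv`.
    toTarget : ∀ {k x y i j} (w : Walk/ k x y) → nodes/ w ⊆ S → π i ∈ nodes/ w → π j ≡ y →
               Star Step i j
    toTarget []      _  (here πi≡x) πj≡y = fibre-connected (trans πi≡x (sym πj≡y))
    toTarget (_ ∷ w) w⊆ (there πi∈) πj≡y = toTarget w (w⊆ ∘ there) πi∈ πj≡y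
    toTarget ((i′ , j′ , a , refl , refl) ∷ w) w⊆ (here πi≡x) πj≡y =
      fibre-connected πi≡x ◅◅ (a , inj₂ (w⊆ (here refl) , w⊆ (there (source∈/ w)))) ◅
      toTarget w (w⊆ ∘ there) (source∈/ w) πj≡y

  mergeWalk : ∀ {k i j} → Walk/ k (π i) (π j) → Decomposition G
  mergeWalk {i = i} {j} w = merge G π S λ
    { (inj₁ eq)        → fibre-connected S eq
    ; (inj₂ (a∈ , b∈)) → to-j a∈ ◅◅ Star.reverse (step-sym S) (to-j b∈)
    }
    where
    S = nodes/ w
    to-j : ∀ {a} → π a ∈ S → Star _ a j
    to-j a∈ = toTarget S {j = j} w id a∈ refl

  -- Without a triangle on uv, the contraction creates no parallel edges.
  π-injective-edges : (G′ : Graph n) → (∀ {r} → Adj G′ u r → ¬ Adj G′ v r) →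
    ∀ {a b c d} → Adj G′ a b → Adj G′ c d → π a ≡ π c → π b ≡ π d →
    (a ≡ c × b ≡ d) ⊎ (a ≡ d × b ≡ c)
  π-injective-edges G′ noTriangle {a} {b} {c} {d} ab cd πa≡πc πb≡πd
    with π-fibre {a} {c} πa≡πc | π-fibre {b} {d} πb≡πd
  ... | inj₁ refl                 | inj₁ refl                 = inj₁ (refl , refl)
  ... | inj₁ refl                 | inj₂ (inj₁ (refl , refl)) =
    ⊥-elim (noTriangle (Graph.adj-sym G′ ab) (Graph.adj-sym G′ cd))
  ... | inj₁ refl                 | inj₂ (inj₂ (refl , refl)) =
    ⊥-elim (noTriangle (Graph.adj-sym G′ cd) (Graph.adj-sym G′ ab))
  ... | inj₂ (inj₁ (refl , refl)) | inj₁ refl                 = ⊥-elim (noTriangle ab cd)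
  ... | inj₂ (inj₂ (refl , refl)) | inj₁ refl                 = ⊥-elim (noTriangle cd ab)
  ... | inj₂ (inj₁ (refl , refl)) | inj₂ (inj₁ (refl , refl)) = ⊥-elim (Graph.adj-irrefl G′ ab)
  ... | inj₂ (inj₁ (refl , refl)) | inj₂ (inj₂ (refl , refl)) = inj₂ (refl , refl)
  ... | inj₂ (inj₂ (refl , refl)) | inj₂ (inj₁ (refl , refl)) = inj₂ (refl , refl)
  ... | inj₂ (inj₂ (refl , refl)) | inj₂ (inj₂ (refl , refl)) = ⊥-elim (Graph.adj-irrefl G′ ab)

-- Sufficiency for an edge of `G` in no triangle

module _ {c ℓ₁ ℓ₂ ℓ₃} (K : OrderedField c ℓ₁ ℓ₂ ℓ₃)
         {n} (G G′ : Graph n) (conn : Connected G) (G⊆G′ : G ⊆ᴳ G′) where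

  open LiftedMulticut K G G′ G⊆G′
  open PolytopeProperties K (Edge G′)
  open MulticutProperties K G G′ G⊆G′

  noTriangle⇒facet : ∀ {u v} (uv : Adj G u v) (uv′ : Adj G′ u v) →
                     ¬ InTriangle G′ (edge G′ uv′) → LowerBoundDefinesFacet (edge G′ uv′)
  noTriangle⇒facet {u} {v} uv uv′ ¬triangle = facet X.binary (edge G′ uv′)
    to (index ∘ ∈-allEdges G′) (λ e → sym (lookup-index (∈-allEdges G′ e)))
    (rank ∘ to) (λ j → multicut (D (to j)))
    (λ j → ~⇒0 (D (to j)) {to j} (loHi (to j)) (inj₂ (source∈/ (walk (to j)) , target∈/ (walk (to j)))))
    (λ i j j≢i → offDiagonal (to i) (to j) (λ eq → j≢i (lookup-injective (allEdges-unique G′) eq)))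
    -- Every decomposition of the family merges `u` and `v`, so the family lies on the face.
    (λ j → ~⇒0 (D (to j)) {edge G′ uv′} (ends-edge G′ uv′) (inj₁ πu≡πv))
    (λ j → multicut∈X (D (to j)))
    (λ e → ≁⇒1 (discrete G) {e} (loHi e) λ { (inj₁ lo≡hi) → lo≢hi e lo≡hi })
    (multicut∈X (discrete G))
    where
    open Contraction G uv
    open OrderedField K using (_≈_; 1#)
    to = lookup (allEdges G′)

    loHi : (e : Edge G′) → Ends e (lo e) (hi e)
    loHi _ = inj₁ (refl , refl)

    lo≢hi : (e : Edge G′) → lo e ≢ hi e
    lo≢hi e lo≡hi = Graph.adj-irrefl G′ (subst (Adj G′ (lo e)) (sym lo≡hi) (edge-adj G′ e))

    shortest : (e : Edge G′) → ∃[ k ] Walk/ k (π (lo e)) (π (hi e)) ×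
                                      (∀ {j} → Walk/ j (π (lo e)) (π (hi e)) → k ℕ.≤ j)
    shortest e = let k , w = walk⇒walk/ (conn (lo e) (hi e)) in
      least (λ k → walk/? k (π (lo e)) (π (hi e))) k w

    -- The distance in `G/uv` between the ends of `e`.
    rank : Edge G′ → ℕ
    rank e = proj₁ (shortest e)

    walk : (e : Edge G′) → Walk/ (rank e) (π (lo e)) (π (hi e))
    walk e = proj₁ (proj₂ (shortest e))

    rank≤ : ∀ e {j} → Walk/ j (π (lo e)) (π (hi e)) → rank e ℕ.≤ j
    rank≤ e = proj₂ (proj₂ (shortest e))

    D : Edge G′ → Decomposition G
    D e = mergeWalk {i = lo e} {hi e} (walk e)

    collapsed : ∀ e → π (lo e) ≡ π (hi e) → e ≡ edge G′ uv′
    collapsed e eq with π-fibre {lo e} {hi e} eq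
    ... | inj₁ lo≡hi         = contradiction lo≡hi (lo≢hi e)
    ... | inj₂ (inj₁ ends)   = ends-injective (inj₁ ends) (ends-edge G′ uv′)
    ... | inj₂ (inj₂ (p , q)) = ends-injective (inj₂ (p , q)) (ends-edge G′ uv′)

    noTriangle : ∀ {r} → Adj G′ u r → ¬ Adj G′ v r
    noTriangle ur vr = ¬triangle (neighbour⇒inTriangle G′ uv′ ur vr)

    parallel : ∀ {e f a b} → Ends f a b → Adj G′ a b →
               π (lo e) ≡ π a → π (hi e) ≡ π b → e ≡ f
    parallel {e} f-ends ab p q with π-injective-edges G′ noTriangle (edge-adj G′ e) ab p q
    ... | inj₁ (refl , refl) = ends-injective (inj₁ (refl , refl)) f-ends
    ... | inj₂ (refl , refl) = ends-injective (inj₂ (refl , refl)) f-ends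

    rank-positive : ∀ f → f ≢ edge G′ uv′ → 0 ℕ.< rank f
    rank-positive f f≢e with rank f | walk f
    ... | suc _ | _ = s≤s z≤n
    ... | zero  | w = contradiction (collapsed f (ends w)) f≢e
      where
      ends : ∀ {x y} → Walk/ 0 x y → x ≡ y
      ends [] = refl

    merged⇒< : ∀ e f → f ≢ e → Merged G π (nodes/ (walk f)) (lo e) (hi e) → rank e ℕ.< rank f
    -- Only `uv` is contracted to a single node: its rank is zero, all other ranks are positive.
    merged⇒< e f f≢e (inj₁ eq) with refl ← collapsed e eq = ℕ.≤-<-trans
      (rank≤ e (subst (Walk/ 0 (π (lo e))) eq [])) (rank-positive f f≢e)
    merged⇒< e f f≢e (inj₂ (lo∈ , hi∈)) with onWalk (walk f) lo∈ hi∈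
    ... | inj₁ (j , j<k , w)  = ℕ.≤-<-trans (rank≤ e w) j<k
    -- Otherwise `e` and `f` have the same ends in `G/uv`, and they coincide because no parallel
    -- edges arise.
    ... | inj₂ (inj₁ (p , q)) = contradiction
      (sym (parallel {e} {f} (inj₁ (refl , refl)) (edge-adj G′ f) p q)) f≢e
    ... | inj₂ (inj₂ (p , q)) = contradiction
      (sym (parallel {e} {f} (inj₂ (refl , refl)) (Graph.adj-sym G′ (edge-adj G′ f)) p q)) f≢e

    offDiagonal : ∀ e f → f ≢ e → multicut (D f) e ≈ 1# ⊎ rank e ℕ.< rank f
    offDiagonal e f f≢e = decide (Decomposition._~?_ (D f) (lo e) (hi e))
      where
      decide : Dec (Decomposition._~_ (D f) (lo e) (hi e)) →
               multicut (D f) e ≈ 1# ⊎ rank e ℕ.< rank f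
      decide (yes lo~hi) = inj₂ (merged⇒< e f f≢e lo~hi)
      decide (no  lo≁hi) = inj₁ (≁⇒1 (D f) {e} (loHi e) lo≁hi)

-- Assembly of the facet criterion and the necessary conditions

theorem9 : ∀ {c ℓ₁ ℓ₂ ℓ₃ : Level} (K : OrderedField c ℓ₁ ℓ₂ ℓ₃)
    {n : ℕ} (G G′ : Graph n) → Connected G → (G⊆G′ : G ⊆ᴳ G′) →
    ∀ {u v : Fin n} (uv : Adj G′ u v) →
    let open LiftedMulticut K G G′ G⊆G′
        e = edge G′ uv
    in
      (Adj G u v → LowerBoundDefinesFacet e ⇔ (¬ InTriangle G′ e))
      ×
      (¬ Adj G u v → LowerBoundDefinesFacet e →
        (¬ InTriangle G′ e)
        ×
        (∀ {s t} → IsCutVertex G u v s → IsCutVertex G u v t → s ≢ t →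
          ¬ ((s ≡ u × t ≡ v) ⊎ (s ≡ v × t ≡ u)) →
          DistanceAtLeast G′ 3 s t)
        ×
        (¬ (∃[ s ] ∃[ s′ ] ∃[ t ]
              TriangleOn G′ s s′ t
              × IsSeparating G u v (s ∷ s′ ∷ [])
              × IsCutVertex G u v t)))
theorem9 K {n} G G′ conn G⊆G′ {u} {v} uv =
  (λ uvᴳ → mk⇔ facet⇒¬triangle (noTriangle⇒facet K G G′ conn G⊆G′ uvᴳ uv)) ,
  λ _ facet →
    facet⇒¬triangle facet ,
    facet⇒distance≥3 uv conn facet ,
    λ (s , s′ , t , triangle , separating , t-cut) →
      let ss′ , st , ts′ = triangleOn⇒adj G′ triangle
      in facet⇒noSeparatingTriangle uv conn facet st ss′ ts′ (meets ∘ separating) t-cut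
  where
  open LiftedMulticut K G G′ G⊆G′
  open MulticutProperties K G G′ G⊆G′

  facet⇒¬triangle : LowerBoundDefinesFacet (edge G′ uv) → ¬ InTriangle G′ (edge G′ uv)
  facet⇒¬triangle facet triangle with r , ur , vr ← inTriangle⇒neighbour G′ uv triangle =
    -- The third node `r` of the triangle is a common neighbour of `u` and `v`, which are themselves
    -- the pair joined on the face.
    ¬facet-neighbours uv conn ur vr (λ { refl → Graph.adj-irrefl G′ uv }) (λ _ → id) facet

  meets : ∀ {s s′ : Fin n} {xs} → Any (_∈ s ∷ s′ ∷ []) xs → s ∈ xs ⊎ s′ ∈ xs
  meets (here (here refl))         = inj₁ (here refl)
  meets (here (there (here refl))) = inj₂ (here refl)
  meets (there x∈)                 = Sum.map there there (meets x∈)
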